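{- Let $p\in S^{2k+1}\mathbb{C}^N$. Then for every $q$ with $0\le q\le N$, $$\mathrm{rank}\big(p^{\wedge q}_{k,k+1}\big)\ \leq\ \sum_{j=0}^k(-1)^j\dim\big(\Lambda^{q-j}\mathbb{C}^N\otimes S^{k-j}\mathbb{C}^{N*}\big).$$
   Context: $S^d\mathbb{C}^N$ is the space of homogeneous polynomials of degree $d$ in $x_1,\dots,x_N$ (a basis of $\mathbb{C}^N$) over $\mathbb{C}$; $S^s\mathbb{C}^{N*}$ is the space of homogeneous constant-coefficient differential operators of order $s$; $\Lambda^{r}\mathbb{C}^N$ is the exterior power, with $\Lambda^r\mathbb{C}^N=0$ for $r<0$. For $p\in S^d\mathbb{C}^N$, the Koszul flattening with parameters $s,q$ is the linear map $$p^{\wedge q}_{s,d-s}:\Lambda^q\mathbb{C}^N\otimes S^s\mathbb{C}^{N*}\to\Lambda^{q+1}\mathbb{C}^N\otimes S^{d-s-1}\mathbb{C}^N,\qquad X\otimes D\mapsto\sum_{i=1}^N (x_i\wedge X)\otimes\frac{\partial}{\partial x_i}\big(D(p)\big).$$ It is the composition of $\mathrm{id}\otimes p_{s,d-s}$, where $p_{s,d-s}(D)=D(p)$, with the exterior derivative map $\delta_{q,d-s}:\Lambda^q\mathbb{C}^N\otimes S^{d-s}\mathbb{C}^N\to\Lambda^{q+1}\mathbb{C}^N\otimes S^{d-s-1}\mathbb{C}^N$, $X\otimes g\mapsto\sum_i(x_i\wedge X)\otimes\partial g/\partial x_i$. -}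

module Defs where

open import Algebra.Apartness.Bundles using (HeytingField; HeytingCommutativeRing)
open import Algebra.Bundles using (CommutativeRing)
import Algebra.Definitions.RawMonoid as RawMonoidDefinitions
import Algebra.Properties.Ring as RingProperties
import Algebra.Properties.Semiring.Sum as SemiringSum
open import Data.Bool.Base using (if_then_else_)
import Data.Bool.Properties as Bool
open import Data.Fin.Base using (Fin; zero; suc)
import Data.Fin.Properties as Fin
open import Data.Fin.Subset using (Subset; inside; outside; ∣_∣)
open import Data.Integer.Base as ℤ using (ℤ; +_; -1ℤ)
import Data.Integer.Properties as ℤ
open import Data.List.Base as List using (List; []; _∷_; _++_)
open import Data.List.Membership.Propositional using (_∈_)
open import Data.List.Membership.Propositional.Properties
  using (∈-map⁺; ∈-map⁻; ∈-++⁺ˡ; ∈-++⁺ʳ; ∈-concat⁺′; ∈-concat⁻′; ∈-upTo⁺; ∈-upTo⁻; ∈-filter⁺; ∈-filter⁻;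
         ∈-cartesianProduct⁺; ∈-cartesianProduct⁻; ∈-lookup)
open import Data.List.Relation.Unary.All as All using (All)
import Data.List.Relation.Unary.All.Properties as All
open import Data.List.Relation.Unary.AllPairs as AllPairs using (AllPairs)
import Data.List.Relation.Unary.AllPairs.Properties as AllPairs
open import Data.List.Relation.Unary.Any as Any using (here; there)
open import Data.List.Relation.Unary.Any.Properties using (lookup-index)
open import Data.List.Relation.Unary.Unique.Propositional using (Unique)
open import Data.List.Relation.Unary.Unique.Propositional.Properties
  using (map⁺; ++⁺; concat⁺; upTo⁺; filter⁺; cartesianProduct⁺)
open import Data.Nat.Base as ℕ using (ℕ; zero; suc; _∸_)
open import Data.Nat.GeneralisedArithmetic using (fold)
import Data.Nat.ListAction as ListAction
import Data.Nat.Properties as ℕ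
open import Data.Product.Base using (∃-syntax; _×_; _,_; proj₁; proj₂)
open import Data.Product.Properties using (≡-dec)
open import Data.Vec.Base as Vec using (Vec; []; _∷_; lookup; _[_]%=_)
import Data.Vec.Properties as Vec
open import Function.Base using (_∘_; id)
open import Level using (_⊔_)
open import Relation.Binary.Definitions using (DecidableEquality)
open import Relation.Binary.PropositionalEquality as ≡ using (_≡_; _≢_)
open import Relation.Nullary using (¬_; Dec; yes; no; does; contradiction)
open import Relation.Unary using (Pred)

private
  lookup-injective : {A : Set} {xs : List A} → Unique xs →
                     ∀ i j → List.lookup xs i ≡ List.lookup xs j → i ≡ j
  lookup-injective (x∉ AllPairs.∷ u) zero    zero    eq = ≡.refl
  lookup-injective (x∉ AllPairs.∷ u) zero    (suc j) eq = contradiction eq (All.lookup x∉ (∈-lookup j))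
  lookup-injective (x∉ AllPairs.∷ u) (suc i) zero    eq =
    contradiction (≡.sym eq) (All.lookup x∉ (∈-lookup i))
  lookup-injective (x∉ AllPairs.∷ u) (suc i) (suc j) eq = ≡.cong suc (lookup-injective u i j eq)

-- The monomials of degree d in N variables, as exponent vectors.
exponents : (N d : ℕ) → List (Vec ℕ N)
exponents zero    zero    = [] ∷ []
exponents zero    (suc d) = []
exponents (suc N) d       =
  List.concat (List.map (λ a → List.map (a ∷_) (exponents N (d ∸ a))) (List.upTo (suc d)))

allSubsets : (N : ℕ) → List (Subset N)
allSubsets zero    = [] ∷ []
allSubsets (suc N) =
  List.map (outside ∷_) (allSubsets N) ++ List.map (inside ∷_) (allSubsets N)

-- A subset X = {i₁ < … < iᵣ} indexes the basis vector x_{i₁} ∧ … ∧ x_{iᵣ} of Λʳ.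
-- The degree r is an integer, so there is no basis vector for r < 0.
subsetsOfSize : (N : ℕ) (r : ℤ) → List (Subset N)
subsetsOfSize N r = List.filter (λ X → + ∣ X ∣ ℤ.≟ r) (allSubsets N)

basisΛ⊗S : (N : ℕ) (r : ℤ) (d : ℕ) → List (Subset N × Vec ℕ N)
basisΛ⊗S N r d = List.cartesianProduct (subsetsOfSize N r) (exponents N d)

-- dim (Λʳ ⊗ Sᵈ); see Λ⊗S-dimension below.
dimΛ⊗S : (N : ℕ) (r : ℤ) (d : ℕ) → ℕ
dimΛ⊗S N r d = List.length (basisΛ⊗S N r d)

∈-exponents⁺ : ∀ {N} (α : Vec ℕ N) → α ∈ exponents N (Vec.sum α)
∈-exponents⁺ []      = here ≡.refl
∈-exponents⁺ (a ∷ α) = ∈-concat⁺′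
  (∈-map⁺ (a ∷_) (≡.subst (λ d → α ∈ exponents _ d) (≡.sym (ℕ.m+n∸m≡n a (Vec.sum α))) (∈-exponents⁺ α)))
  (∈-map⁺ _ (∈-upTo⁺ (ℕ.s≤s (ℕ.m≤m+n a (Vec.sum α)))))

∈-exponents⁻ : ∀ {N} d {α : Vec ℕ N} → α ∈ exponents N d → Vec.sum α ≡ d
∈-exponents⁻ {zero}  zero {[]} _ = ≡.refl
∈-exponents⁻ {suc N} d α∈
  with xs , α∈xs , xs∈ ← ∈-concat⁻′ (List.map (λ a → List.map (a ∷_) (exponents N (d ∸ a))) (List.upTo (suc d))) α∈
  with a , a∈ , ≡.refl ← ∈-map⁻ (λ a → List.map (a ∷_) (exponents N (d ∸ a))) xs∈
  with β , β∈ , ≡.refl ← ∈-map⁻ (a ∷_) α∈xs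
  = ≡.trans (≡.cong (a ℕ.+_) (∈-exponents⁻ (d ∸ a) β∈)) (ℕ.m+[n∸m]≡n (ℕ.s≤s⁻¹ (∈-upTo⁻ a∈)))

exponents-unique : ∀ N d → Unique (exponents N d)
exponents-unique zero    zero    = All.[] AllPairs.∷ AllPairs.[]
exponents-unique zero    (suc d) = AllPairs.[]
exponents-unique (suc N) d       = concat⁺
  (All.map⁺ (All.universal (λ a → map⁺ Vec.∷-injectiveʳ (exponents-unique N (d ∸ a))) _))
  (AllPairs.map⁺ (AllPairs.map (λ a≢b {_} (α∈ , α∈′) → a≢b (heads α∈ α∈′)) (upTo⁺ (suc d))))
  where
  heads : ∀ {a b α xs ys} → α ∈ List.map (a ∷_) xs → α ∈ List.map (b ∷_) ys → a ≡ b
  heads {a} {b} α∈ α∈′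
    with _ , _ , ≡.refl ← ∈-map⁻ (a ∷_) α∈
    with _ , _ , ≡.refl ← ∈-map⁻ (b ∷_) α∈′ = ≡.refl

∈-allSubsets : ∀ {N} (X : Subset N) → X ∈ allSubsets N
∈-allSubsets []            = here ≡.refl
∈-allSubsets (outside ∷ X) = ∈-++⁺ˡ (∈-map⁺ _ (∈-allSubsets X))
∈-allSubsets (inside  ∷ X) = ∈-++⁺ʳ _ (∈-map⁺ _ (∈-allSubsets X))

allSubsets-unique : ∀ N → Unique (allSubsets N)
allSubsets-unique zero    = All.[] AllPairs.∷ AllPairs.[]
allSubsets-unique (suc N) = ++⁺
  (map⁺ Vec.∷-injectiveʳ (allSubsets-unique N)) (map⁺ Vec.∷-injectiveʳ (allSubsets-unique N))
  λ (X∈ , X∈′) → disjoint X∈ X∈′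
  where
  disjoint : ∀ {X : Subset (suc N)} {xs ys} →
             X ∈ List.map (outside ∷_) xs → ¬ (X ∈ List.map (inside ∷_) ys)
  disjoint X∈ X∈′
    with _ , _ , ≡.refl ← ∈-map⁻ (outside ∷_) X∈
    with _ , _ , () ← ∈-map⁻ (inside ∷_) X∈′

∈-basisΛ⊗S⁺ : ∀ {N r d} {X : Subset N} {α : Vec ℕ N} →
              + ∣ X ∣ ≡ r → Vec.sum α ≡ d → (X , α) ∈ basisΛ⊗S N r d
∈-basisΛ⊗S⁺ {X = X} {α} ∣X∣≡r ≡.refl =
  ∈-cartesianProduct⁺ (∈-filter⁺ _ (∈-allSubsets X) ∣X∣≡r) (∈-exponents⁺ α)

∈-basisΛ⊗S⁻ : ∀ {N r d} {X : Subset N} {α : Vec ℕ N} →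
              (X , α) ∈ basisΛ⊗S N r d → + ∣ X ∣ ≡ r × Vec.sum α ≡ d
∈-basisΛ⊗S⁻ {N} {r} {d} Xα∈
  with X∈ , α∈ ← ∈-cartesianProduct⁻ (subsetsOfSize N r) (exponents N d) Xα∈
  = proj₂ (∈-filter⁻ (λ X → + ∣ X ∣ ℤ.≟ r) {xs = allSubsets N} X∈) , ∈-exponents⁻ d α∈

basisΛ⊗S-unique : ∀ N r d → Unique (basisΛ⊗S N r d)
basisΛ⊗S-unique N r d =
  cartesianProduct⁺ (filter⁺ _ (allSubsets-unique N)) (exponents-unique N d)

-- ∑_{j=0}^{k} (-1)ʲ aⱼ
alternatingSum : (k : ℕ) (a : ℕ → ℕ) → ℤ
alternatingSum k a = List.foldr ℤ._+_ (+ 0) (List.map (λ j → (-1ℤ ℤ.^ j) ℤ.* (+ a j)) (List.upTo (suc k)))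

module KoszulFlattening {c ℓ₁ ℓ₂} (F : HeytingField c ℓ₁ ℓ₂) where

  private
    R : CommutativeRing c ℓ₁
    R = HeytingCommutativeRing.commutativeRing (HeytingField.heytingCommutativeRing F)

  open CommutativeRing R hiding (zero) renaming (Carrier to K)
  open RawMonoidDefinitions +-rawMonoid using () renaming (_×_ to _⋆_)
  open SemiringSum semiring using (sum)

  -- ℂ is a Heyting field of characteristic 0, whether or not its equality is taken to be decidable.
  CharacteristicZero : Set ℓ₁
  CharacteristicZero = ∀ n → ¬ (suc n ⋆ 1# ≈ 0#)

  ∑[_] : {A : Set} → List A → (A → K) → K
  ∑[ xs ] f = List.foldr _+_ 0# (List.map f xs)

  module _ {I : Set} where

    _≐_ : (u v : I → K) → Set ℓ₁
    u ≐ v = ∀ i → u i ≈ v i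

    combination : ∀ {n} → (Fin n → K) → (Fin n → I → K) → I → K
    combination a v i = sum (λ m → a m * v m i)

    Independent : ∀ {n} → (Fin n → I → K) → Set (c ⊔ ℓ₁)
    Independent v = ∀ a → combination a v ≐ (λ _ → 0#) → ∀ m → a m ≈ 0#

    record HasDimension {ℓ} (U : Pred (I → K) ℓ) (n : ℕ) : Set (c ⊔ ℓ₁ ⊔ ℓ) where
      field
        basis       : Fin n → I → K
        basis∈      : ∀ m → U (basis m)
        independent : Independent basis
        spanning    : ∀ u → U u → ∃[ a ] u ≐ combination a basis

    -- The dimension as the supremum of the sizes of independent families: this also makes sense
    -- when equality in K is undecidable and U need not have an explicit basis.
    DimensionAtMost : ∀ {ℓ} → Pred (I → K) ℓ → ℤ → Set (c ⊔ ℓ₁ ⊔ ℓ)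
    DimensionAtMost U b =
      ∀ n (v : Fin n → I → K) → (∀ m → U (v m)) → Independent v → + n ℤ.≤ b

    dimension≤ : ∀ {ℓ} {U : Pred (I → K) ℓ} {n b} →
                 HasDimension U n → DimensionAtMost U b → + n ℤ.≤ b
    dimension≤ h bound = bound _ basis basis∈ independent
      where open HasDimension h

  private
    ∑[]-zero : {A : Set} (xs : List A) {f : A → K} → (∀ {x} → x ∈ xs → f x ≈ 0#) → ∑[ xs ] f ≈ 0#
    ∑[]-zero []       f≈0 = refl
    ∑[]-zero (x ∷ xs) f≈0 =
      trans (+-cong (f≈0 (here ≡.refl)) (∑[]-zero xs (f≈0 ∘ there))) (+-identityˡ 0#)

    sum-zero : ∀ {n} {f : Fin n → K} → (∀ m → f m ≈ 0#) → sum f ≈ 0#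
    sum-zero {zero}  f≈0 = refl
    sum-zero {suc n} f≈0 = trans (+-cong (f≈0 zero) (sum-zero (f≈0 ∘ suc))) (+-identityˡ 0#)

    sum-single : ∀ {n} {f : Fin n → K} m → (∀ m′ → m ≢ m′ → f m′ ≈ 0#) → sum f ≈ f m
    sum-single zero    f≈0 =
      trans (+-congˡ (sum-zero λ m → f≈0 (suc m) λ ())) (+-identityʳ _)
    sum-single (suc m) f≈0 =
      trans (+-cong (f≈0 zero λ ()) (sum-single m λ m′ m≢m′ → f≈0 (suc m′) (m≢m′ ∘ Fin.suc-injective)))
            (+-identityˡ _)

    ⋆-zero : ∀ n {x} → x ≈ 0# → n ⋆ x ≈ 0#
    ⋆-zero zero    x≈0 = refl
    ⋆-zero (suc n) x≈0 = trans (+-cong x≈0 (⋆-zero n x≈0)) (+-identityˡ 0#)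

  module _ {I : Set} (_≟_ : DecidableEquality I) {xs : List I} (xs-unique : Unique xs) where

    private
      e : I → I → K
      e i j = if does (i ≟ j) then 1# else 0#

      e-diagonal : ∀ i → e i i ≈ 1#
      e-diagonal i with i ≟ i
      ... | yes _  = refl
      ... | no i≢i = contradiction ≡.refl i≢i

      e-off : ∀ {i j} → i ≢ j → e i j ≈ 0#
      e-off {i} {j} i≢j with i ≟ j
      ... | yes i≡j = contradiction i≡j i≢j
      ... | no _    = refl

      combination-lookup : ∀ a m → combination a (e ∘ List.lookup xs) (List.lookup xs m) ≈ a m
      combination-lookup a m = trans
        (sum-single m λ m′ m≢m′ →
          trans (*-congˡ (e-off (m≢m′ ∘ ≡.sym ∘ lookup-injective xs-unique m′ m))) (zeroʳ _))
        (trans (*-congˡ (e-diagonal _)) (*-identityʳ _))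

    coordinateSubspace-dimension : ∀ {ℓ} {U : Pred (I → K) ℓ} →
      (∀ {u} → U u → ∀ i → ¬ (i ∈ xs) → u i ≈ 0#) →
      (∀ {u} → (∀ i → ¬ (i ∈ xs) → u i ≈ 0#) → U u) →
      HasDimension U (List.length xs)
    coordinateSubspace-dimension U⇒ ⇒U = record
      { basis       = e ∘ List.lookup xs
      ; basis∈      = λ m → ⇒U λ i i∉ → e-off λ where ≡.refl → i∉ (∈-lookup m)
      ; independent = λ a a≐0 m → trans (sym (combination-lookup a m)) (a≐0 _)
      ; spanning    = λ u Uu → u ∘ List.lookup xs , λ i → spans u Uu i (Any.any? (i ≟_) xs)
      }
      where
      spans : ∀ u → _ → ∀ i → Dec (i ∈ xs) →
              u i ≈ combination (u ∘ List.lookup xs) (e ∘ List.lookup xs) i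
      spans u Uu i (yes i∈) = ≡.subst
        (λ j → u j ≈ combination (u ∘ List.lookup xs) (e ∘ List.lookup xs) j)
        (≡.sym (lookup-index i∈)) (sym (combination-lookup (u ∘ List.lookup xs) (Any.index i∈)))
      spans u Uu i (no  i∉) = trans (U⇒ Uu i i∉) (sym (sum-zero
        {f = λ m → u (List.lookup xs m) * e (List.lookup xs m) i} λ m →
        trans (*-congˡ (e-off λ where ≡.refl → i∉ (∈-lookup m))) (zeroʳ _)))

  Image : ∀ {ℓ} {I J : Set} → ((I → K) → (J → K)) → Pred (I → K) ℓ → Pred (J → K) (c ⊔ ℓ₁ ⊔ ℓ)
  Image f U w = ∃[ u ] U u × w ≐ f u

  -- The rank of the restriction of f to the subspace U is at most b.
  RankAtMost : ∀ {ℓ} {I J : Set} → ((I → K) → (J → K)) → Pred (I → K) ℓ → ℤ → Set (c ⊔ ℓ₁ ⊔ ℓ)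
  RankAtMost f U b = DimensionAtMost (Image f U) b

  module _ {N : ℕ} where

    -- f represents ∑_α f(α) x^α.  As an element of S^s K^{N*} it represents the constant-coefficient
    -- operator ∑_β f(β) ∂^β.  Finiteness of the support is only imposed through homogeneity.
    Poly : Set c
    Poly = Vec ℕ N → K

    S^ : ℕ → Pred Poly ℓ₁
    S^ d f = ∀ α → Vec.sum α ≢ d → f α ≈ 0#

    -- ∂(x^{α+eᵢ})/∂xᵢ = (αᵢ + 1) x^α
    ∂ : Fin N → Poly → Poly
    ∂ i f α = suc (lookup α i) ⋆ f (α [ i ]%= suc)

    ∂^ : Vec ℕ N → Poly → Poly
    ∂^ β p = List.foldr (λ i f → fold f (∂ i) (lookup β i)) p (List.allFin N)

    -- The map p_{s,d-s} : D ↦ D(p) on operators D of order s.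
    flattening : (s : ℕ) → Poly → (Poly → Poly)
    flattening s p D α = ∑[ exponents N s ] λ β → D β * ∂^ β p α

    -- u represents ∑_{X,α} u(X,α) x_X ⊗ x^α, with x_X as described at subsetsOfSize.
    Form : Set c
    Form = Subset N × Vec ℕ N → K

    Λ^_⊗S^_ : ℤ → ℕ → Pred Form ℓ₁
    (Λ^ r ⊗S^ d) u = ∀ X α → ¬ (+ ∣ X ∣ ≡ r × Vec.sum α ≡ d) → u (X , α) ≈ 0#

    id⊗ : (Poly → Poly) → (Form → Form)
    id⊗ f u (X , α) = f (λ β → u (X , β)) α

  -- The coefficients of xᵢ ∧ ω, where ω represents ∑_X ω(X) x_X.  Moving x_{i+1} past x₀ changes
  -- the sign.
  x[_]∧_ : ∀ {N} → Fin N → (Subset N → K) → (Subset N → K)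
  (x[ zero  ]∧ ω) (inside  ∷ X) = ω (outside ∷ X)
  (x[ zero  ]∧ ω) (outside ∷ X) = 0#
  (x[ suc i ]∧ ω) (inside  ∷ X) = - (x[ i ]∧ (ω ∘ (inside ∷_))) X
  (x[ suc i ]∧ ω) (outside ∷ X) = (x[ i ]∧ (ω ∘ (outside ∷_))) X

  module _ {N : ℕ} where

    δ : Form {N} → Form {N}
    δ u (Y , α) = sum λ i → (x[ i ]∧ (λ X → ∂ i (λ γ → u (X , γ)) α)) Y

    koszulFlattening : (s : ℕ) → Poly {N} → Form {N} → Form {N}
    koszulFlattening s p = δ ∘ id⊗ (flattening s p)

  Λ⊗S-dimension : ∀ N r d → HasDimension (Λ^_⊗S^_ {N} r d) (dimΛ⊗S N r d)
  Λ⊗S-dimension N r d = coordinateSubspace-dimension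
    (≡-dec (Vec.≡-dec Bool._≟_) (Vec.≡-dec ℕ._≟_)) (basisΛ⊗S-unique N r d)
    (λ u∈ (X , α) Xα∉ → u∈ X α λ (eq , eq′) → Xα∉ (∈-basisΛ⊗S⁺ eq eq′))
    (λ u≈0 X α ∉deg → u≈0 (X , α) (∉deg ∘ ∈-basisΛ⊗S⁻))

  private
    ∂-S^ : ∀ {N d} (i : Fin N) {f : Poly} → S^ (suc d) f → S^ d (∂ i f)
    ∂-S^ i f∈ α ∣α∣≢d =
      ⋆-zero (suc (lookup α i)) (f∈ _ λ eq → ∣α∣≢d (ℕ.suc-injective (≡.trans (≡.sym (sum-%= α i)) eq)))
      where
      sum-%= : ∀ {N} (α : Vec ℕ N) i → Vec.sum (α [ i ]%= suc) ≡ suc (Vec.sum α)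
      sum-%= (a ∷ α) zero    = ≡.refl
      sum-%= (a ∷ α) (suc i) = ≡.trans (≡.cong (a ℕ.+_) (sum-%= α i)) (ℕ.+-suc a (Vec.sum α))

    ∂^-S^ : ∀ {N d} (β : Vec ℕ N) {p : Poly} → S^ (Vec.sum β ℕ.+ d) p → S^ d (∂^ β p)
    ∂^-S^ {N} {d} β {p} p∈ =
      along (List.allFin N) (≡.subst (λ m → S^ (m ℕ.+ d) p) (≡.sym (sum-lookup β)) p∈)
      where
      sum-tabulate : ∀ {n} {A : Set} (h : Fin n → A) (g : A → ℕ) →
                     ListAction.sum (List.map g (List.tabulate h)) ≡ Vec.sum (Vec.tabulate (g ∘ h))
      sum-tabulate {zero}  h g = ≡.refl
      sum-tabulate {suc n} h g = ≡.cong (g (h zero) ℕ.+_) (sum-tabulate (h ∘ suc) g)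

      sum-lookup : ∀ {N} (β : Vec ℕ N) →
                   ListAction.sum (List.map (lookup β) (List.allFin N)) ≡ Vec.sum β
      sum-lookup β =
        ≡.trans (sum-tabulate id (lookup β)) (≡.cong Vec.sum (Vec.tabulate∘lookup β))

      times : ∀ i m {d f} → S^ (m ℕ.+ d) f → S^ d (fold f (∂ i) m)
      times i zero    f∈ = f∈
      times i (suc m) {d} {f} f∈ =
        ∂-S^ i (times i m (≡.subst (λ d → S^ d f) (≡.sym (ℕ.+-suc m d)) f∈))

      along : ∀ is {d} → S^ (ListAction.sum (List.map (lookup β) is) ℕ.+ d) p →
              S^ d (List.foldr (λ i f → fold f (∂ i) (lookup β i)) p is)
      along []       p∈ = p∈
      along (i ∷ is) {d} p∈ = times i (lookup β i) (along is (≡.subst (λ m → S^ m p) shuffle p∈))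
        where
        rest = ListAction.sum (List.map (lookup β) is)
        shuffle : (lookup β i ℕ.+ rest) ℕ.+ d ≡ rest ℕ.+ (lookup β i ℕ.+ d)
        shuffle = ≡.trans (≡.cong (ℕ._+ d) (ℕ.+-comm (lookup β i) rest))
                          (ℕ.+-assoc rest (lookup β i) d)

    ∧-zero : ∀ {N} r (i : Fin N) {ω} → (∀ X → + ∣ X ∣ ≢ r → ω X ≈ 0#) →
             ∀ Y → + ∣ Y ∣ ≢ ℤ.suc r → (x[ i ]∧ ω) Y ≈ 0#
    ∧-zero r zero    ω≈0 (inside  ∷ Y) ∣Y∣≢ = ω≈0 (outside ∷ Y) (∣Y∣≢ ∘ ≡.cong ℤ.suc)
    ∧-zero r zero    ω≈0 (outside ∷ Y) ∣Y∣≢ = refl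
    ∧-zero r (suc i) ω≈0 (inside  ∷ Y) ∣Y∣≢ = trans (-‿cong (∧-zero (ℤ.pred r) i
      (λ X ∣X∣≢ → ω≈0 (inside ∷ X) λ eq → ∣X∣≢ (≡.trans (≡.sym (ℤ.pred-suc (+ ∣ X ∣))) (≡.cong ℤ.pred eq)))
      Y λ eq → ∣Y∣≢ (≡.cong ℤ.suc (≡.trans eq (ℤ.suc-pred r)))))
      (RingProperties.-0#≈0# ring)
    ∧-zero r (suc i) ω≈0 (outside ∷ Y) ∣Y∣≢ = ∧-zero r i (λ X → ω≈0 (outside ∷ X)) Y ∣Y∣≢

  flattening-S^ : ∀ {N} s {e} {p : Poly {N}} → S^ (s ℕ.+ e) p → ∀ D → S^ e (flattening s p D)
  flattening-S^ s {e} {p} p∈ D α ∣α∣≢e = ∑[]-zero (exponents _ s) λ {β} β∈ → trans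
    (*-congˡ (∂^-S^ β (≡.subst (λ m → S^ (m ℕ.+ e) p) (≡.sym (∈-exponents⁻ s β∈)) p∈) α ∣α∣≢e))
    (zeroʳ _)

  koszulFlattening-Λ⊗S : ∀ {N} s {e r} {p : Poly {N}} {u : Form} →
    S^ (s ℕ.+ suc e) p → (Λ^ r ⊗S^ s) u → (Λ^ (ℤ.suc r) ⊗S^ e) (koszulFlattening s p u)
  koszulFlattening-Λ⊗S {N} s {e} {r} {p} {u} p∈ u∈ Y α ∉deg = sum-zero λ i → ∧-zero′ i
    where
    g : Fin _ → Subset _ → K
    g i X = ∂ i (flattening s p (λ β → u (X , β))) α

    g-zero : ∀ i X → + ∣ X ∣ ≢ r → g i X ≈ 0#
    g-zero i X ∣X∣≢ = ⋆-zero (suc (lookup α i)) (∑[]-zero (exponents N s) λ {β} _ →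
      trans (*-congʳ (u∈ X β (∣X∣≢ ∘ proj₁))) (zeroˡ _))

    all-zero : ∀ {N} (i : Fin N) {ω} → (∀ X → ω X ≈ 0#) → ∀ Y → (x[ i ]∧ ω) Y ≈ 0#
    all-zero zero    ω≈0 (inside  ∷ Y) = ω≈0 _
    all-zero zero    ω≈0 (outside ∷ Y) = refl
    all-zero (suc i) ω≈0 (inside  ∷ Y) =
      trans (-‿cong (all-zero i (λ X → ω≈0 (inside ∷ X)) Y)) (RingProperties.-0#≈0# ring)
    all-zero (suc i) ω≈0 (outside ∷ Y) = all-zero i (λ X → ω≈0 (outside ∷ X)) Y

    ∧-zero′ : ∀ i → (x[ i ]∧ g i) Y ≈ 0#
    ∧-zero′ i with Vec.sum α ℕ.≟ e
    ... | yes eq = ∧-zero r i (g-zero i) Y (λ eq′ → ∉deg (eq′ , eq))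
    ... | no neq = all-zero i (λ X → ∂-S^ i (flattening-S^ s p∈ (λ β → u (X , β))) α neq) Y

{-# OPTIONS --safe #-}

-- Identify Sˢ K^{N*} with the polynomials of degree s, and let
-- κ : Λ^{q-1} ⊗ S^{k-1} → Λ^q ⊗ S^k be X ⊗ D ↦ ∑ⱼ (xⱼ ∧ X) ⊗ ∂ⱼ D.  The Koszul flattening of p maps
-- κ(X ⊗ D) to ∑ᵢⱼ (xᵢ ∧ xⱼ ∧ X) ⊗ ∂ᵢ∂ⱼ D(p) = 0, so its rank is at most dim coker κ.
--
-- The complex (Λ ⊗ S , κ) is a tensor product of N complexes in one variable, each with an obvious
-- contraction.  Matching basis vectors along these contractions gives a map h such that κ h u and u
-- have the same coefficient at every basis vector matched from below; hence u - κ h u, which has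
-- the same image as u, is supported on the other ("unpaired") basis vectors.  The matching is
-- perfect away from Λᴺ ⊗ S⁰, so these are counted by the alternating sum.

module Submission where

open import Defs
open import Algebra.Apartness.Bundles using (HeytingField; HeytingCommutativeRing)
import Algebra.Apartness.Properties.HeytingCommutativeRing as HeytingProperties
open import Algebra.Bundles using (CommutativeRing)
import Algebra.Definitions.RawMonoid as RawMonoidDefinitions
import Algebra.Properties.CommutativeSemigroup as CommutativeSemigroupProperties
import Algebra.Properties.Monoid.Mult as MonoidMult
import Algebra.Properties.Ring as RingProperties
import Algebra.Properties.Semiring.Sum as SemiringSum
open import Data.Fin.Base using (Fin; zero; suc; punchIn)
import Data.Fin.Properties as Fin
open import Data.Fin.Subset using (Subset; inside; outside; ∣_∣)
open import Data.Integer as ℤ using (ℤ; +_; _-_; -1ℤ)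
import Data.Integer.Properties as ℤ
open import Data.List.Base as List using (List; []; _∷_; _++_; length; filter; applyUpTo; upTo)
open import Data.List.Membership.Propositional using (_∈_; _∉_)
open import Data.List.Membership.Propositional.Properties
  using (∈-map⁺; ∈-map⁻; ∈-filter⁺; ∈-filter⁻; ∈-allFin)
open import Data.List.Membership.Propositional.Properties.WithK using (unique∧set⇒bag)
import Data.List.Properties as List
open import Data.List.Relation.Binary.BagAndSetEquality using (∼bag⇒↭)
open import Data.List.Relation.Binary.Permutation.Propositional.Properties using (↭-length)
import Data.List.Relation.Unary.All as All
open import Data.List.Relation.Unary.AllPairs using (_∷_)
open import Data.List.Relation.Unary.Any as Any using (here; there)
open import Data.List.Relation.Unary.Any.Properties using (lookup-index)
open import Data.List.Relation.Unary.Unique.Propositional using (Unique)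
import Data.List.Relation.Unary.Unique.Propositional.Properties as Unique
open import Data.Nat.Base using (ℕ; zero; suc; _+_; _*_; _∸_; _≤_; z≤n; s≤s)
open import Data.Nat.GeneralisedArithmetic using (fold)
import Data.Nat.Properties as ℕ
open import Data.Product.Base as Product using (_×_; _,_; proj₁; proj₂; uncurry; ∃-syntax)
open import Data.Vec.Base as Vec using (Vec; []; _∷_; lookup; _[_]%=_)
open import Data.Vec.Functional using (insertAt)
import Data.Vec.Functional.Properties as Functional
import Data.Vec.Properties as Vec
open import Function.Base using (_∘_)
open import Function.Bundles using (mk⇔)
open import Level using (_⊔_)
open import Relation.Binary.PropositionalEquality as ≡ using (_≡_; _≢_)
import Relation.Binary.Reasoning.Setoid as SetoidReasoning
open import Relation.Nullary using (¬_; ¬?; Dec; yes; no; contradiction)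
open import Relation.Nullary.Decidable using (decidable-stable; ¬¬-excluded-middle)
open import Relation.Unary using (Decidable)

-- Alternating sums and lengths of filtered lists.

alternatingSum-suc : ∀ k a → alternatingSum (suc k) a ≡ + a 0 - alternatingSum k (a ∘ suc)
alternatingSum-suc k a = ≡.cong₂ ℤ._+_ (ℤ.*-identityˡ (+ a 0)) (≡.trans
  (≡.cong (List.foldr ℤ._+_ (+ 0)) (≡.trans
    (List.map-applyUpTo suc (λ j → (-1ℤ ℤ.^ j) ℤ.* (+ a j)) (suc k))
    (≡.sym (List.map-upTo (λ j → (-1ℤ ℤ.^ suc j) ℤ.* (+ a (suc j))) (suc k)))))
  (negate (upTo (suc k))))
  where
  negate : ∀ js → List.foldr ℤ._+_ (+ 0) (List.map (λ j → (-1ℤ ℤ.^ suc j) ℤ.* (+ a (suc j))) js) ≡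
                  ℤ.- List.foldr ℤ._+_ (+ 0) (List.map (λ j → (-1ℤ ℤ.^ j) ℤ.* (+ a (suc j))) js)
  negate []       = ≡.refl
  negate (j ∷ js) = ≡.trans
    (≡.cong₂ ℤ._+_
      (≡.trans (ℤ.*-assoc -1ℤ (-1ℤ ℤ.^ j) (+ a (suc j))) (ℤ.-1*i≡-i _))
      (negate js))
    (≡.sym (ℤ.neg-distrib-+ ((-1ℤ ℤ.^ j) ℤ.* (+ a (suc j))) _))

alternatingSum-cong : ∀ k {a b} → (∀ j → a j ≡ b j) → alternatingSum k a ≡ alternatingSum k b
alternatingSum-cong k a≡b = ≡.cong (List.foldr ℤ._+_ (+ 0))
  (List.map-cong (λ j → ≡.cong (λ m → (-1ℤ ℤ.^ j) ℤ.* (+ m)) (a≡b j)) (upTo (suc k)))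

length-filter-split : ∀ {A : Set} {P : A → Set} (P? : Decidable P) (xs : List A) →
                      length (filter P? xs) + length (filter (¬? ∘ P?) xs) ≡ length xs
length-filter-split P? [] = ≡.refl
length-filter-split P? (x ∷ xs) with P? x
... | yes _ = ≡.cong suc (length-filter-split P? xs)
... | no  _ = ≡.trans (ℕ.+-suc _ _) (≡.cong suc (length-filter-split P? xs))

-- In the Koszul complex each coordinate i contributes the acyclic pairing (i ∉ X, αᵢ = a) ↔
-- (i ∈ X, αᵢ = a + 1), which misses only (i ∈ X, αᵢ = 0).  A pair (X , α) is matched through its
-- first coordinate not of the latter kind; Paired means that this coordinate lies in X.
data Paired : ∀ {N} → Subset N → Vec ℕ N → Set where
  here  : ∀ {N} {X : Subset N} {a α} → Paired (inside ∷ X) (suc a ∷ α)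
  there : ∀ {N} {X : Subset N} {α} → Paired X α → Paired (inside ∷ X) (0 ∷ α)

paired? : ∀ {N} (X : Subset N) α → Dec (Paired X α)
paired? []            []          = no λ ()
paired? (outside ∷ X) (a ∷ α)     = no λ ()
paired? (inside  ∷ X) (suc a ∷ α) = yes here
paired? (inside  ∷ X) (zero  ∷ α) with paired? X α
... | yes p = yes (there p)
... | no ¬p = no λ { (there p) → ¬p p }

-- The empty case only makes the function total: the vector with every index in `X` and all
-- exponents zero has no mate and is sent to itself.
partner : ∀ {N} → Subset N × Vec ℕ N → Subset N × Vec ℕ N
partner ([]          , [])        = [] , []
partner (outside ∷ X , a ∷ α)     = inside ∷ X , suc a ∷ α
partner (inside  ∷ X , suc a ∷ α) = outside ∷ X , a ∷ α
partner (inside  ∷ X , zero  ∷ α) = Product.map (inside ∷_) (0 ∷_) (partner (X , α))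

partner-involutive : ∀ {N} (x : Subset N × Vec ℕ N) → partner (partner x) ≡ x
partner-involutive ([]          , [])        = ≡.refl
partner-involutive (outside ∷ X , a ∷ α)     = ≡.refl
partner-involutive (inside  ∷ X , suc a ∷ α) = ≡.refl
partner-involutive (inside  ∷ X , zero  ∷ α) =
  ≡.cong (Product.map (inside ∷_) (0 ∷_)) (partner-involutive (X , α))

partner-paired : ∀ {N} {X : Subset N} {α} → Paired X α → let (Y , β) = partner (X , α) in
                 ∣ X ∣ ≡ suc ∣ Y ∣ × Vec.sum α ≡ suc (Vec.sum β) × ¬ Paired Y β
partner-paired here = ≡.refl , ≡.refl , λ ()
partner-paired (there p) with eq , eq′ , ¬q ← partner-paired p =
  ≡.cong suc eq , eq′ , λ { (there q) → ¬q q }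

-- An unpaired vector with `X` full has all exponents zero, since the first positive one would make
-- it paired. This is the only vector without a mate, and `∣ X ∣ ≢ N` excludes it.
partner-unpaired : ∀ {N} {X : Subset N} {α} → ¬ Paired X α → ∣ X ∣ ≢ N →
                   let (Y , β) = partner (X , α) in
                   ∣ Y ∣ ≡ suc ∣ X ∣ × Vec.sum β ≡ suc (Vec.sum α) × Paired Y β
partner-unpaired {X = []}          {[]}        ¬p ∣X∣≢ = contradiction ≡.refl ∣X∣≢
partner-unpaired {X = outside ∷ X} {a ∷ α}     ¬p ∣X∣≢ = ≡.refl , ≡.refl , here
partner-unpaired {X = inside  ∷ X} {suc a ∷ α} ¬p ∣X∣≢ = contradiction here ¬p
partner-unpaired {X = inside  ∷ X} {zero ∷ α}  ¬p ∣X∣≢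
  with eq , eq′ , q ← partner-unpaired (¬p ∘ there) (∣X∣≢ ∘ ≡.cong suc) =
  ≡.cong suc eq , eq′ , there q

-- Counting the unpaired basis vectors.

pairedBasis unpairedBasis : (N : ℕ) (r : ℤ) (d : ℕ) → List (Subset N × Vec ℕ N)
pairedBasis   N r d = filter (uncurry paired?) (basisΛ⊗S N r d)
unpairedBasis N r d = filter (¬? ∘ uncurry paired?) (basisΛ⊗S N r d)

pairedBasis-zero : ∀ N r → length (pairedBasis N r 0) ≡ 0
pairedBasis-zero N r = ≡.cong length (List.filter-none (uncurry paired?) {xs = basisΛ⊗S N r 0}
  (All.tabulate λ {(X , α)} x∈ p →
  ℕ.0≢1+n (≡.trans (≡.sym (proj₂ (∈-basisΛ⊗S⁻ {N} {r} x∈))) (proj₁ (proj₂ (partner-paired p))))))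

-- `partner` restricts to a bijection between the two lists, and duplicate-free lists with the same
-- members are permutations of each other. The bound on `r` gives `ℤ.pred r` < `N`, so the vector
-- without a mate does not occur on the right.
pairedBasis-suc : ∀ {N r} d → r ℤ.≤ + N →
                  length (pairedBasis N r (suc d)) ≡ length (unpairedBasis N (ℤ.pred r) d)
pairedBasis-suc {N} {r} d r≤N = ≡.trans (≡.sym (List.length-map partner (pairedBasis N r (suc d))))
  (↭-length (∼bag⇒↭ (unique∧set⇒bag
    (Unique.map⁺ partner-injective (Unique.filter⁺ _ (basisΛ⊗S-unique N r (suc d))))
    (Unique.filter⁺ _ (basisΛ⊗S-unique N (ℤ.pred r) d))
    (mk⇔ to from))))
  where
  partner-injective : ∀ {x y : Subset N × Vec ℕ N} → partner x ≡ partner y → x ≡ y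
  partner-injective {x} {y} eq =
    ≡.trans (≡.sym (partner-involutive x)) (≡.trans (≡.cong partner eq) (partner-involutive y))

  to : ∀ {y} → y ∈ List.map partner (pairedBasis N r (suc d)) → y ∈ unpairedBasis N (ℤ.pred r) d
  to y∈
    with (X , α) , x∈ , ≡.refl ← ∈-map⁻ partner y∈
    with x∈′ , p ← ∈-filter⁻ (uncurry paired?) {xs = basisΛ⊗S N r (suc d)} x∈
    with ∣X∣≡r , Σα≡ ← ∈-basisΛ⊗S⁻ {r = r} x∈′
    with eq , eq′ , ¬q ← partner-paired p
    = ∈-filter⁺ (¬? ∘ uncurry paired?)
        (∈-basisΛ⊗S⁺ (≡.trans (≡.sym (ℤ.pred-suc _))
                        (≡.cong ℤ.pred (≡.trans (≡.cong +_ (≡.sym eq)) ∣X∣≡r)))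
                     (ℕ.suc-injective (≡.trans (≡.sym eq′) Σα≡)))
        ¬q

  from : ∀ {y} → y ∈ unpairedBasis N (ℤ.pred r) d → y ∈ List.map partner (pairedBasis N r (suc d))
  from {Y , β} y∈
    with y∈′ , ¬p ← ∈-filter⁻ (¬? ∘ uncurry paired?) {xs = basisΛ⊗S N (ℤ.pred r) d} y∈
    with ∣Y∣≡r , Σβ≡ ← ∈-basisΛ⊗S⁻ {r = ℤ.pred r} y∈′
    with eq , eq′ , q ← partner-unpaired ¬p (λ ∣Y∣≡N → ℤ.<-irrefl
           (≡.sym (≡.trans (≡.cong ℤ.suc ∣Y∣≡r) (ℤ.suc-pred r)))
           (ℤ.≤-<-trans (≡.subst (r ℤ.≤_) (≡.cong +_ (≡.sym ∣Y∣≡N)) r≤N) (ℤ.+<+ (ℕ.n<1+n _))))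
    = ≡.subst (_∈ List.map partner (pairedBasis N r (suc d))) (partner-involutive (Y , β))
        (∈-map⁺ partner (∈-filter⁺ (uncurry paired?)
          (∈-basisΛ⊗S⁺ (≡.trans (≡.cong +_ eq) (≡.trans (≡.cong ℤ.suc ∣Y∣≡r) (ℤ.suc-pred r)))
                       (≡.trans eq′ (≡.cong suc Σβ≡)))
          q))

-- Unpaired vectors are all vectors minus the paired ones, and the latter are as many as the
-- unpaired vectors one degree lower in both gradings; iterating this produces the signs. As `r` is
-- an integer, it may pass below zero without a separate case.
unpairedBasis-length : ∀ {N r} d → r ℤ.≤ + N →
  + length (unpairedBasis N r d) ≡ alternatingSum d (λ j → dimΛ⊗S N (r - + j) (d ∸ j))
unpairedBasis-length {N} {r} zero r≤N = begin
  + length (unpairedBasis N r 0)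
    ≡⟨ ≡.cong (λ m → + (m + length (unpairedBasis N r 0))) (pairedBasis-zero N r) ⟨
  + (length (pairedBasis N r 0) + length (unpairedBasis N r 0))
                                                ≡⟨ ≡.cong +_ (length-filter-split (uncurry paired?) (basisΛ⊗S N r 0)) ⟩
  + dimΛ⊗S N r 0                                ≡⟨ ≡.cong (λ s → + dimΛ⊗S N s 0) (ℤ.+-identityʳ r) ⟨
  + dimΛ⊗S N (r - + 0) 0                        ≡⟨ ℤ.*-identityˡ _ ⟨
  + 1 ℤ.* (+ dimΛ⊗S N (r - + 0) 0)              ≡⟨ ℤ.+-identityʳ _ ⟨
  + 1 ℤ.* (+ dimΛ⊗S N (r - + 0) 0) ℤ.+ (+ 0)    ∎
  where open ≡.≡-Reasoning
unpairedBasis-length {N} {r} (suc d) r≤N = begin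
  + u                                  ≡⟨ ℤ.+-identityˡ (+ u) ⟨
  + 0 ℤ.+ + u                          ≡⟨ ≡.cong (ℤ._+ + u) (ℤ.+-inverseˡ (+ p)) ⟨
  (ℤ.- + p ℤ.+ + p) ℤ.+ + u            ≡⟨ ℤ.+-assoc (ℤ.- + p) (+ p) (+ u) ⟩
  ℤ.- + p ℤ.+ (+ (p + u))              ≡⟨ ℤ.+-comm (ℤ.- + p) (+ (p + u)) ⟩
  + (p + u) - + p                      ≡⟨ ≡.cong₂ (λ m n → + m - n)
                                            (length-filter-split (uncurry paired?) (basisΛ⊗S N r (suc d)))
                                            (≡.trans (≡.cong +_ (pairedBasis-suc {N} {r} d r≤N))
                                              (unpairedBasis-length {N} {ℤ.pred r} d (ℤ.i≤j⇒pred[i]≤j r≤N))) ⟩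
  + dimΛ⊗S N r (suc d) - alternatingSum d (λ j → dimΛ⊗S N (ℤ.pred r - + j) (d ∸ j))
                                       ≡⟨ ≡.cong₂ (λ s t → + dimΛ⊗S N s (suc d) - t) (≡.sym (ℤ.+-identityʳ r))
                                            (alternatingSum-cong d λ j → ≡.cong (λ s → dimΛ⊗S N s (d ∸ j)) (shift j)) ⟩
  + dimΛ⊗S N (r - + 0) (suc d) - alternatingSum d (λ j → dimΛ⊗S N (r - + suc j) (d ∸ j))
                                       ≡⟨ alternatingSum-suc d (λ j → dimΛ⊗S N (r - + j) (suc d ∸ j)) ⟨
  alternatingSum (suc d) (λ j → dimΛ⊗S N (r - + j) (suc d ∸ j)) ∎
  where
  open ≡.≡-Reasoning
  p = length (pairedBasis N r (suc d))
  u = length (unpairedBasis N r (suc d))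

  shift : ∀ j → ℤ.pred r - + j ≡ r - + suc j
  shift j = ≡.trans (≡.cong (ℤ._- + j) (ℤ.+-comm -1ℤ r))
    (≡.trans (ℤ.+-assoc r -1ℤ (ℤ.- + j)) (≡.cong (λ s → r ℤ.+ s) (≡.sym (ℤ.neg-distrib-+ (+ 1) (+ j)))))

-- Monomials are listed by increasing exponent of the first variable, so those free of it come first
-- and the others are that variable times a monomial of degree `d`, in the same order.
exponents-suc : ∀ N d → exponents (suc N) (suc d) ≡
  List.map (0 ∷_) (exponents N (suc d)) ++ List.map (_[ zero ]%= suc) (exponents (suc N) d)
exponents-suc N d = ≡.cong (List.map (0 ∷_) (exponents N (suc d)) ++_) (begin
  List.concat (List.map (λ a → List.map (a ∷_) (exponents N (suc d ∸ a))) (applyUpTo suc (suc d)))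
    ≡⟨ ≡.cong List.concat (List.map-applyUpTo suc (λ a → List.map (a ∷_) (exponents N (suc d ∸ a))) (suc d)) ⟩
  List.concat (applyUpTo level⁺ (suc d))
    ≡⟨ ≡.cong List.concat (List.map-upTo level⁺ (suc d)) ⟨
  List.concat (List.map level⁺ (upTo (suc d)))
    ≡⟨ ≡.cong List.concat (List.map-cong (λ a → List.map-∘ (exponents N (d ∸ a))) (upTo (suc d))) ⟩
  List.concat (List.map (List.map (_[ zero ]%= suc) ∘ level) (upTo (suc d)))
    ≡⟨ ≡.cong List.concat (List.map-∘ (upTo (suc d))) ⟩
  List.concat (List.map (List.map (_[ zero ]%= suc)) (List.map level (upTo (suc d))))
    ≡⟨ List.concat-map (List.map level (upTo (suc d))) ⟩
  List.map (_[ zero ]%= suc) (exponents (suc N) d) ∎)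
  where
  open ≡.≡-Reasoning

  level level⁺ : ℕ → List (Vec ℕ (suc N))
  level  a = List.map (a ∷_) (exponents N (d ∸ a))
  level⁺ a = List.map (suc a ∷_) (exponents N (d ∸ a))

module _ {c ℓ₁ ℓ₂} (F : HeytingField c ℓ₁ ℓ₂) where

  open KoszulFlattening F

  private
    H : HeytingCommutativeRing c ℓ₁ ℓ₂
    H = HeytingField.heytingCommutativeRing F

    R : CommutativeRing c ℓ₁
    R = HeytingCommutativeRing.commutativeRing H

  open CommutativeRing R hiding (zero; _+_; _*_; _-_) renaming (Carrier to K)
  open CommutativeRing R using () renaming (_+_ to infixl 6 _⊕_; _*_ to infixl 7 _⊛_; _-_ to infixl 6 _⊖_)
  open HeytingField F using (_#_; #-irrefl; tight; #⇒invertible)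
  open HeytingProperties H using (1#0; x-0≈x)
  open RingProperties ring
    using (-0#≈0#; -‿involutive; -‿distribˡ-*; -‿distribʳ-*; -‿+-comm; -1*x≈-x)
  open RawMonoidDefinitions +-rawMonoid using () renaming (_×_ to _⋆_)
  open MonoidMult +-monoid using () renaming (×-congʳ to ⋆-congʳ; ×-assocˡ to ⋆-assocˡ)
  open CommutativeSemigroupProperties +-commutativeSemigroup using (interchange)
  open SemiringSum semiring using (sum; sum-cong-≋; ∑-distrib-+; sum-remove; *-distribʳ-sum)
  open SetoidReasoning setoid

  -- Finite sums over the field.

  sum-zero : ∀ {n} {f : Fin n → K} → (∀ i → f i ≈ 0#) → sum f ≈ 0#
  sum-zero {zero}  f≈0 = refl
  sum-zero {suc n} f≈0 = trans (+-cong (f≈0 zero) (sum-zero {n} (f≈0 ∘ suc))) (+-identityˡ 0#)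

  sum-neg : ∀ {n} (f : Fin n → K) → sum (λ i → - f i) ≈ - sum f
  sum-neg {zero}  f = sym -0#≈0#
  sum-neg {suc n} f = trans (+-congˡ (sum-neg (f ∘ suc))) (-‿+-comm (f zero) (sum (f ∘ suc)))

  -- The first row cancels against the first column, and what remains is a smaller matrix of the
  -- same kind.
  alternating⇒sum≈0 : ∀ {n} (A : Fin n → Fin n → K) → (∀ i → A i i ≈ 0#) →
                      (∀ i j → A i j ≈ - A j i) → sum (λ i → sum (A i)) ≈ 0#
  alternating⇒sum≈0 {zero}  A diag anti = refl
  alternating⇒sum≈0 {suc n} A diag anti = begin
    (A zero zero ⊕ r) ⊕ sum (λ i → A (suc i) zero ⊕ sum (λ j → A (suc i) (suc j)))
      ≈⟨ +-cong (trans (+-congʳ (diag zero)) (+-identityˡ r)) (∑-distrib-+ {n} _ _) ⟩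
    r ⊕ (sum (λ i → A (suc i) zero) ⊕ sum (λ i → sum (λ j → A (suc i) (suc j))))
      ≈⟨ +-congˡ (+-cong (trans (sum-cong-≋ {n} (λ i → anti (suc i) zero)) (sum-neg {n} _))
           (alternating⇒sum≈0 (λ i j → A (suc i) (suc j)) (diag ∘ suc) (λ i j → anti (suc i) (suc j)))) ⟩
    r ⊕ (- r ⊕ 0#)  ≈⟨ +-congˡ (+-identityʳ (- r)) ⟩
    r ⊕ - r         ≈⟨ -‿inverseʳ r ⟩
    0# ∎
    where r = sum (λ j → A zero (suc j))

  ∑-cong : {A : Set} (xs : List A) {f g : A → K} → (∀ x → f x ≈ g x) → ∑[ xs ] f ≈ ∑[ xs ] g
  ∑-cong []       f≈g = refl
  ∑-cong (x ∷ xs) f≈g = +-cong (f≈g x) (∑-cong xs f≈g)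

  ∑-zero : {A : Set} (xs : List A) {f : A → K} → (∀ {x} → x ∈ xs → f x ≈ 0#) → ∑[ xs ] f ≈ 0#
  ∑-zero []       f≈0 = refl
  ∑-zero (x ∷ xs) f≈0 =
    trans (+-cong (f≈0 (here ≡.refl)) (∑-zero xs (f≈0 ∘ there))) (+-identityˡ 0#)

  ∑-++ : {A : Set} (xs ys : List A) (f : A → K) → ∑[ xs ++ ys ] f ≈ ∑[ xs ] f ⊕ ∑[ ys ] f
  ∑-++ []       ys f = sym (+-identityˡ _)
  ∑-++ (x ∷ xs) ys f = trans (+-congˡ (∑-++ xs ys f)) (sym (+-assoc (f x) _ _))

  ∑-map : {A B : Set} (g : A → B) (xs : List A) (f : B → K) → ∑[ List.map g xs ] f ≈ ∑[ xs ] (f ∘ g)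
  ∑-map g []       f = refl
  ∑-map g (x ∷ xs) f = +-congˡ (∑-map g xs f)

  ∑-sum-comm : {A : Set} (xs : List A) {n : ℕ} (f : A → Fin n → K) →
               ∑[ xs ] (λ x → sum (f x)) ≈ sum (λ j → ∑[ xs ] (λ x → f x j))
  ∑-sum-comm []       {n} f = sym (sum-zero {n} λ _ → refl)
  ∑-sum-comm (x ∷ xs) {n} f = trans (+-congˡ (∑-sum-comm xs f)) (sym (∑-distrib-+ {n} (f x) _))

  ⋆-∑ : {A : Set} (n : ℕ) (xs : List A) (f g : A → K) →
        n ⋆ ∑[ xs ] (λ x → f x ⊛ g x) ≈ ∑[ xs ] (λ x → f x ⊛ (n ⋆ g x))
  ⋆-∑ zero    xs f g = sym (∑-zero xs λ _ → zeroʳ _)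
  ⋆-∑ (suc n) xs f g = trans (+-congˡ (⋆-∑ n xs f g)) (distribute xs)
    where
    distribute : ∀ xs → ∑[ xs ] (λ x → f x ⊛ g x) ⊕ ∑[ xs ] (λ x → f x ⊛ (n ⋆ g x)) ≈
                        ∑[ xs ] (λ x → f x ⊛ (suc n ⋆ g x))
    distribute []       = +-identityˡ 0#
    distribute (x ∷ xs) = trans (interchange _ _ _ _) (+-cong (sym (distribˡ _ _ _)) (distribute xs))

  -- Linear independence in Kᵐ

  -- Gaussian elimination on the first coordinate. With a pivot, one vector and one coordinate are
  -- removed. Without one, the first coordinate vanishes throughout by tightness of apartness, and
  -- only the coordinate is dropped.
  independent⇒≤ : ∀ {n m} (v : Fin n → Fin m → K) → Independent v → n ≤ m
  independent⇒≤ {zero}          v ind = z≤n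
  independent⇒≤ {suc n} {zero}  v ind =
    -- With no coordinates every relation holds, so the one with all coefficients 1 would give 1 ≈
    -- 0.
    contradiction 1#0 (#-irrefl (ind (λ _ → 1#) (λ ()) zero))
  -- The existence of a pivot need not be decidable. The goal is a decidable inequality of naturals,
  -- hence stable under double negation, so excluded middle may be used for the pivot.
  independent⇒≤ {suc n} {suc m} v ind = decidable-stable (suc n ℕ.≤? suc m) λ ≰ →
    ¬¬-excluded-middle {A = ∃[ i ] v i zero # 0#} λ where
      (yes (i , vᵢ#0)) → ≰ (s≤s (independent⇒≤ (reduced i vᵢ#0) (reduced-independent i vᵢ#0)))
      (no ∄#0)         → ≰ (ℕ.m≤n⇒m≤1+n (independent⇒≤ (λ i → v i ∘ suc) (tail-independent ∄#0)))
    where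
    tail-independent : ¬ (∃[ i ] v i zero # 0#) → Independent (λ i → v i ∘ suc)
    tail-independent ∄#0 a a≐0 = ind a λ where
      zero    → sum-zero {suc n} λ i →
        trans (*-congˡ (proj₁ (tight _ _) (λ vᵢ#0 → ∄#0 (i , vᵢ#0)))) (zeroʳ (a i))
      (suc l) → a≐0 l

    module _ i (vᵢ#0 : v i zero # 0#) where

      multiplier : Fin n → K
      multiplier j = v (punchIn i j) zero ⊛ proj₁ (#⇒invertible vᵢ#0)

      reduce : Fin n → Fin (suc m) → K
      reduce j l = v (punchIn i j) l ⊖ multiplier j ⊛ v i l

      reduced : Fin n → Fin m → K
      reduced j l = reduce j (suc l)

      reduce-zero : ∀ j → reduce j zero ≈ 0#
      reduce-zero j = trans (+-congˡ (-‿cong (begin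
        v (punchIn i j) zero ⊛ inv ⊛ v i zero         ≈⟨ *-assoc _ _ _ ⟩
        -- Apartness provides an inverse of the difference of two elements, here of `v i zero ⊖ 0#`.
        v (punchIn i j) zero ⊛ (inv ⊛ v i zero)       ≈⟨ *-congˡ (*-congˡ (x-0≈x _)) ⟨
        v (punchIn i j) zero ⊛ (inv ⊛ (v i zero ⊖ 0#)) ≈⟨ *-congˡ (proj₁ (proj₂ (#⇒invertible vᵢ#0))) ⟩
        v (punchIn i j) zero ⊛ 1#                     ≈⟨ *-identityʳ _ ⟩
        v (punchIn i j) zero ∎))) (-‿inverseʳ _)
        where inv = proj₁ (#⇒invertible vᵢ#0)

      -- The coefficient at the pivot collects everything the multipliers subtract, so a relation
      -- among the reduced vectors lifts to one among the original vectors.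
      extend : (Fin n → K) → Fin (suc n) → K
      extend a = insertAt a i (- sum (λ j → a j ⊛ multiplier j))

      combination-extend : ∀ a l → combination (extend a) v l ≈ combination a reduce l
      combination-extend a l = begin
        sum (λ j → extend a j ⊛ v j l)
          ≈⟨ sum-remove {i = i} (λ j → extend a j ⊛ v j l) ⟩
        extend a i ⊛ v i l ⊕ sum (λ j → extend a (punchIn i j) ⊛ v (punchIn i j) l)
          ≈⟨ +-cong (*-congʳ (reflexive (Functional.insertAt-lookup a i _)))
               (sum-cong-≋ {n} λ j → *-congʳ (reflexive (Functional.insertAt-punchIn a i _ j))) ⟩
        - sum (λ j → a j ⊛ multiplier j) ⊛ v i l ⊕ s
          ≈⟨ +-congʳ (begin
               - sum (λ j → a j ⊛ multiplier j) ⊛ v i l     ≈⟨ -‿distribˡ-* _ _ ⟨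
               - (sum (λ j → a j ⊛ multiplier j) ⊛ v i l)   ≈⟨ -‿cong (*-distribʳ-sum (v i l) (λ j → a j ⊛ multiplier j)) ⟩
               - sum (λ j → a j ⊛ multiplier j ⊛ v i l)     ≈⟨ sum-neg {n} _ ⟨
               sum (λ j → - (a j ⊛ multiplier j ⊛ v i l))   ∎) ⟩
        sum (λ j → - (a j ⊛ multiplier j ⊛ v i l)) ⊕ s
          ≈⟨ +-comm _ s ⟩
        s ⊕ sum (λ j → - (a j ⊛ multiplier j ⊛ v i l))
          ≈⟨ ∑-distrib-+ {n} _ _ ⟨
        sum (λ j → a j ⊛ v (punchIn i j) l ⊖ a j ⊛ multiplier j ⊛ v i l)
          ≈⟨ sum-cong-≋ {n} (λ j → trans
               (+-congˡ (trans (-‿cong (*-assoc _ _ _)) (-‿distribʳ-* (a j) _)))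
               (sym (distribˡ (a j) _ _))) ⟩
        sum (λ j → a j ⊛ reduce j l) ∎
        where s = sum (λ j → a j ⊛ v (punchIn i j) l)

      reduced-independent : Independent reduced
      reduced-independent a a≐0 j = trans
        (reflexive (≡.sym (Functional.insertAt-punchIn a i _ j)))
        (ind (extend a) (λ l → trans (combination-extend a l) (vanishes l)) (punchIn i j))
        where
        vanishes : ∀ l → combination a reduce l ≈ 0#
        vanishes zero    = sum-zero {n} λ j → trans (*-congˡ (reduce-zero j)) (zeroʳ (a j))
        vanishes (suc l) = a≐0 l

  -- Linear functionals

  -- Linearity is recorded for one output coordinate at a time; a map between spaces of families is
  -- treated through its coordinate functionals. The field `cong` is needed because families are
  -- compared only pointwise.
  record Linear {I : Set} (φ : (I → K) → K) : Set (c ⊔ ℓ₁) where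
    field
      cong : ∀ {u v} → u ≐ v → φ u ≈ φ v
      homo : ∀ a u v → φ (λ i → a ⊛ u i ⊕ v i) ≈ a ⊛ φ u ⊕ φ v

    distrib-+ : ∀ u v → φ (λ i → u i ⊕ v i) ≈ φ u ⊕ φ v
    distrib-+ u v = trans (cong λ i → +-congʳ (sym (*-identityˡ (u i))))
      (trans (homo 1# u v) (+-congʳ (*-identityˡ (φ u))))

    zero-homo : φ (λ _ → 0#) ≈ 0#
    -- The zero family is -1 times itself plus itself, so by `homo` its value cancels.
    zero-homo = begin
      φ (λ _ → 0#)
        ≈⟨ cong (λ _ → sym (trans (+-congʳ (zeroʳ _)) (+-identityˡ 0#))) ⟩
      φ (λ _ → - 1# ⊛ 0# ⊕ 0#)                         ≈⟨ homo (- 1#) _ _ ⟩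
      - 1# ⊛ φ (λ _ → 0#) ⊕ φ (λ _ → 0#)
        ≈⟨ +-congʳ (trans (sym (-‿distribˡ-* 1# _)) (-‿cong (*-identityˡ _))) ⟩
      - φ (λ _ → 0#) ⊕ φ (λ _ → 0#)                    ≈⟨ -‿inverseˡ _ ⟩
      0#                                               ∎

    vanish : ∀ {u} → (∀ i → u i ≈ 0#) → φ u ≈ 0#
    vanish u≈0 = trans (cong u≈0) zero-homo

    scale : ∀ a u → φ (λ i → a ⊛ u i) ≈ a ⊛ φ u
    scale a u = trans (cong λ i → sym (+-identityʳ _))
      (trans (homo a u (λ _ → 0#)) (trans (+-congˡ zero-homo) (+-identityʳ _)))

    neg : ∀ u → φ (λ i → - u i) ≈ - φ u
    neg u = trans (cong λ i → sym (-1*x≈-x (u i))) (trans (scale (- 1#) u) (-1*x≈-x (φ u)))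

    sum-homo : ∀ {n} (v : Fin n → I → K) → φ (λ i → sum (λ m → v m i)) ≈ sum (λ m → φ (v m))
    sum-homo {zero}  v = zero-homo
    sum-homo {suc n} v = trans (distrib-+ (v zero) _) (+-congˡ (sum-homo (v ∘ suc)))

    combination-homo : ∀ {n} (a : Fin n → K) v → φ (combination a v) ≈ sum (λ m → a m ⊛ φ (v m))
    combination-homo {n} a v =
      trans (sum-homo (λ m i → a m ⊛ v m i)) (sum-cong-≋ {n} λ m → scale (a m) (v m))

    ∑-homo : {A : Set} (xs : List A) (v : A → I → K) (b : A → K) →
             φ (λ i → ∑[ xs ] (λ x → v x i ⊛ b x)) ≈ ∑[ xs ] (λ x → φ (v x) ⊛ b x)
    ∑-homo []       v b = zero-homo
    ∑-homo (x ∷ xs) v b = trans (distrib-+ (λ i → v x i ⊛ b x) _) (+-cong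
      (trans (cong λ i → *-comm (v x i) (b x)) (trans (scale (b x) (v x)) (*-comm (b x) _)))
      (∑-homo xs v b))

  module _ {I : Set} where

    coordinate-linear : (i : I) → Linear (λ u → u i)
    coordinate-linear i = record { cong = λ u≐v → u≐v i ; homo = λ _ _ _ → refl }

    zero-linear : Linear {I} (λ _ → 0#)
    zero-linear = record
      { cong = λ _ → refl
      ; homo = λ a _ _ → sym (trans (+-identityʳ _) (zeroʳ a))
      }

    +-linear : {φ ψ : (I → K) → K} → Linear φ → Linear ψ → Linear (λ u → φ u ⊕ ψ u)
    +-linear φ-linear ψ-linear = record
      { cong = λ u≐v → +-cong (φ.cong u≐v) (ψ.cong u≐v)
      ; homo = λ a u v → trans (+-cong (φ.homo a u v) (ψ.homo a u v))
          (trans (interchange _ _ _ _) (+-congʳ (sym (distribˡ a _ _))))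
      }
      where
      module φ = Linear φ-linear
      module ψ = Linear ψ-linear

    neg-linear : {φ : (I → K) → K} → Linear φ → Linear (λ u → - φ u)
    neg-linear φ-linear = record
      { cong = λ u≐v → -‿cong (cong u≐v)
      ; homo = λ a u v → trans (-‿cong (homo a u v))
          (trans (sym (-‿+-comm _ _)) (+-congʳ (-‿distribʳ-* a _)))
      }
      where open Linear φ-linear

    *-linear : {φ : (I → K) → K} (b : K) → Linear φ → Linear (λ u → φ u ⊛ b)
    *-linear b φ-linear = record
      { cong = λ u≐v → *-congʳ (cong u≐v)
      ; homo = λ a u v → trans (*-congʳ (homo a u v))
          (trans (distribʳ b _ _) (+-congʳ (*-assoc a _ b)))
      }
      where open Linear φ-linear

    ⋆-linear : {φ : (I → K) → K} (n : ℕ) → Linear φ → Linear (λ u → n ⋆ φ u)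
    ⋆-linear zero    φ-linear = zero-linear
    ⋆-linear (suc n) φ-linear = +-linear φ-linear (⋆-linear n φ-linear)

    sum-linear : ∀ {n} {φ : Fin n → (I → K) → K} → (∀ m → Linear (φ m)) →
                 Linear (λ u → sum (λ m → φ m u))
    sum-linear {zero}  φ-linear = zero-linear
    sum-linear {suc n} φ-linear = +-linear (φ-linear zero) (sum-linear (φ-linear ∘ suc))

    ∑-linear : {A : Set} (xs : List A) {φ : A → (I → K) → K} → (∀ x → Linear (φ x)) →
               Linear (λ u → ∑[ xs ] (λ x → φ x u))
    ∑-linear []       φ-linear = zero-linear
    ∑-linear (x ∷ xs) φ-linear = +-linear (φ-linear x) (∑-linear xs φ-linear)

    ∘-linear : {J : Set} {φ : (J → K) → K} {L : (I → K) → J → K} →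
               Linear φ → (∀ j → Linear (λ u → L u j)) → Linear (λ u → φ (L u))
    ∘-linear φ-linear L-linear = record
      { cong = λ u≐v → φ.cong λ j → Linear.cong (L-linear j) u≐v
      ; homo = λ a u v → trans (φ.cong λ j → Linear.homo (L-linear j) a u v) (φ.homo a _ _)
      }
      where module φ = Linear φ-linear

  -- Exterior multiplication

  ∧-linear : ∀ {N} (i : Fin N) Y → Linear (λ ω → (x[ i ]∧ ω) Y)
  ∧-linear zero    (inside  ∷ Y) = coordinate-linear (outside ∷ Y)
  ∧-linear zero    (outside ∷ Y) = zero-linear
  ∧-linear (suc i) (inside  ∷ Y) =
    neg-linear (∘-linear (∧-linear i Y) λ X → coordinate-linear (inside ∷ X))
  ∧-linear (suc i) (outside ∷ Y) = ∘-linear (∧-linear i Y) λ X → coordinate-linear (outside ∷ X)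

  private module ∧ {N} i Y = Linear (∧-linear {N} i Y)

  ∧-alternating : ∀ {N} (i : Fin N) ω Y → (x[ i ]∧ (x[ i ]∧ ω)) Y ≈ 0#
  ∧-alternating zero    ω (inside  ∷ Y) = refl
  ∧-alternating zero    ω (outside ∷ Y) = refl
  ∧-alternating (suc i) ω (inside  ∷ Y) = trans
    (trans (-‿cong (∧.neg i Y _)) (-‿involutive _)) (∧-alternating i (ω ∘ (inside ∷_)) Y)
  ∧-alternating (suc i) ω (outside ∷ Y) = ∧-alternating i (ω ∘ (outside ∷_)) Y

  -- Recursion on the position. If exactly one index is `zero`, the sign arises from moving the
  -- other variable past the first one. If both are successors, passing an `inside` head adds two
  -- signs to either product.
  ∧-anticomm : ∀ {N} (i j : Fin N) ω Y → (x[ i ]∧ (x[ j ]∧ ω)) Y ≈ - (x[ j ]∧ (x[ i ]∧ ω)) Y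
  ∧-anticomm zero    zero    ω (inside  ∷ Y) = sym -0#≈0#
  ∧-anticomm zero    zero    ω (outside ∷ Y) = sym -0#≈0#
  ∧-anticomm zero    (suc j) ω (inside  ∷ Y) = sym (-‿involutive _)
  ∧-anticomm zero    (suc j) ω (outside ∷ Y) = sym (trans (-‿cong (∧.zero-homo j Y)) -0#≈0#)
  ∧-anticomm (suc i) zero    ω (inside  ∷ Y) = refl
  ∧-anticomm (suc i) zero    ω (outside ∷ Y) = trans (∧.zero-homo i Y) (sym -0#≈0#)
  ∧-anticomm (suc i) (suc j) ω (inside  ∷ Y) = -‿cong (trans (∧.neg i Y _)
    (trans (-‿cong (∧-anticomm i j (ω ∘ (inside ∷_)) Y)) (-‿cong (sym (∧.neg j Y _)))))
  ∧-anticomm (suc i) (suc j) ω (outside ∷ Y) = ∧-anticomm i j (ω ∘ (outside ∷_)) Y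

  -- A general predicate on sizes lets the recursion proceed: past an `inside` head, `P` is replaced
  -- by `P ∘ suc`.
  ∧-vanish : ∀ {N} (P : ℕ → Set) (i : Fin N) {ω} → (∀ X → P (suc ∣ X ∣) → ω X ≈ 0#) →
             ∀ Y → P ∣ Y ∣ → (x[ i ]∧ ω) Y ≈ 0#
  ∧-vanish P zero    ω≈0 (inside  ∷ Y) PY = ω≈0 (outside ∷ Y) PY
  ∧-vanish P zero    ω≈0 (outside ∷ Y) PY = refl
  ∧-vanish P (suc i) ω≈0 (inside  ∷ Y) PY =
    trans (-‿cong (∧-vanish (P ∘ suc) i (λ X → ω≈0 (inside ∷ X)) Y PY)) -0#≈0#
  ∧-vanish P (suc i) ω≈0 (outside ∷ Y) PY = ∧-vanish P i (λ X → ω≈0 (outside ∷ X)) Y PY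

  -- On the symbol of a constant-coefficient operator D, y[ j ]· is D ↦ ∂ⱼ D.
  y[_]·_ : ∀ {N} → Fin N → Poly {N} → Poly {N}
  (y[ zero  ]· g) (zero  ∷ β) = 0#
  (y[ zero  ]· g) (suc b ∷ β) = g (b ∷ β)
  (y[ suc j ]· g) (b     ∷ β) = (y[ j ]· (g ∘ (b ∷_))) β

  y-linear : ∀ {N} (j : Fin N) β → Linear (λ g → (y[ j ]· g) β)
  y-linear zero    (zero  ∷ β) = zero-linear
  y-linear zero    (suc b ∷ β) = coordinate-linear (b ∷ β)
  y-linear (suc j) (b     ∷ β) = ∘-linear (y-linear j β) λ γ → coordinate-linear (b ∷ γ)

  -- Summation by parts over monomials of fixed degree.

  ∑-exponents-zero : ∀ N (f : Poly) → ∑[ exponents (suc N) 0 ] f ≈ ∑[ exponents N 0 ] (f ∘ (0 ∷_))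
  ∑-exponents-zero N f = trans
    (reflexive (≡.cong (λ xs → ∑[ xs ] f) (List.++-identityʳ (List.map (0 ∷_) (exponents N 0)))))
    (∑-map (0 ∷_) (exponents N 0) f)

  ∑-exponents-suc : ∀ N d (f : Poly) → ∑[ exponents (suc N) (suc d) ] f ≈
    ∑[ exponents N (suc d) ] (f ∘ (0 ∷_)) ⊕ ∑[ exponents (suc N) d ] (λ β → f (β [ zero ]%= suc))
  ∑-exponents-suc N d f = begin
    ∑[ exponents (suc N) (suc d) ] f
      ≡⟨ ≡.cong (λ xs → ∑[ xs ] f) (exponents-suc N d) ⟩
    ∑[ List.map (0 ∷_) (exponents N (suc d)) ++ List.map (_[ zero ]%= suc) (exponents (suc N) d) ] f
      ≈⟨ ∑-++ (List.map (0 ∷_) (exponents N (suc d))) _ f ⟩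
    ∑[ List.map (0 ∷_) (exponents N (suc d)) ] f ⊕ ∑[ List.map (_[ zero ]%= suc) (exponents (suc N) d) ] f
      ≈⟨ +-cong (∑-map (0 ∷_) (exponents N (suc d)) f) (∑-map (_[ zero ]%= suc) (exponents (suc N) d) f) ⟩
    ∑[ exponents N (suc d) ] (f ∘ (0 ∷_)) ⊕ ∑[ exponents (suc N) d ] (λ β → f (β [ zero ]%= suc)) ∎

  -- A multiple of a variable has no constant term.
  ∑-y-zero : ∀ {N} (j : Fin N) (g G : Poly) → ∑[ exponents N 0 ] (λ β → (y[ j ]· g) β ⊛ G β) ≈ 0#
  ∑-y-zero {suc N} zero    g G = trans (∑-exponents-zero N _) (∑-zero (exponents N 0) λ _ → zeroˡ _)
  ∑-y-zero {suc N} (suc j) g G =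
    trans (∑-exponents-zero N _) (∑-y-zero j (g ∘ (0 ∷_)) (G ∘ (0 ∷_)))

  -- The product of `g` with the `j`-th variable lives on the exponents `γ [ j ]%= suc`, with value
  -- `g γ` there. For `suc j` the sum is split by whether the first variable occurs: one half uses
  -- induction on `N`, the other on the degree, ending at degree 0 with `∑-y-zero`.
  ∑-y-suc : ∀ {N} (j : Fin N) d (g G : Poly) → ∑[ exponents N (suc d) ] (λ β → (y[ j ]· g) β ⊛ G β) ≈
                                      ∑[ exponents N d ] (λ γ → g γ ⊛ G (γ [ j ]%= suc))
  ∑-y-suc {suc N} zero d g G = trans (∑-exponents-suc N d _) (trans
    (+-cong (∑-zero (exponents N (suc d)) λ _ → zeroˡ _)
            (∑-cong (exponents (suc N) d) λ { (b ∷ β) → refl }))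
    (+-identityˡ _))
  ∑-y-suc {suc N} (suc j) zero g G = begin
    ∑[ exponents (suc N) 1 ] (λ β → (y[ suc j ]· g) β ⊛ G β)
      ≈⟨ ∑-exponents-suc N 0 _ ⟩
    ∑[ exponents N 1 ] (λ β → (y[ j ]· (g ∘ (0 ∷_))) β ⊛ G (0 ∷ β)) ⊕
    ∑[ exponents (suc N) 0 ] (λ β → (y[ suc j ]· g) (β [ zero ]%= suc) ⊛ G (β [ zero ]%= suc))
      ≈⟨ +-cong (∑-y-suc j 0 (g ∘ (0 ∷_)) (G ∘ (0 ∷_)))
           (trans (∑-exponents-zero N _) (∑-y-zero j (g ∘ (1 ∷_)) (G ∘ (1 ∷_)))) ⟩
    ∑[ exponents N 0 ] (λ γ → g (0 ∷ γ) ⊛ G (0 ∷ γ [ j ]%= suc)) ⊕ 0#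
      ≈⟨ +-identityʳ _ ⟩
    ∑[ exponents N 0 ] (λ γ → g (0 ∷ γ) ⊛ G (0 ∷ γ [ j ]%= suc))
      ≈⟨ ∑-exponents-zero N _ ⟨
    ∑[ exponents (suc N) 0 ] (λ γ → g γ ⊛ G (γ [ suc j ]%= suc)) ∎
  ∑-y-suc {suc N} (suc j) (suc d) g G = begin
    ∑[ exponents (suc N) (suc (suc d)) ] (λ β → (y[ suc j ]· g) β ⊛ G β)
      ≈⟨ ∑-exponents-suc N (suc d) _ ⟩
    ∑[ exponents N (suc (suc d)) ] (λ β → (y[ j ]· (g ∘ (0 ∷_))) β ⊛ G (0 ∷ β)) ⊕
    ∑[ exponents (suc N) (suc d) ] (λ β → (y[ suc j ]· g) (β [ zero ]%= suc) ⊛ G (β [ zero ]%= suc))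
      ≈⟨ +-cong (∑-y-suc j (suc d) (g ∘ (0 ∷_)) (G ∘ (0 ∷_)))
           (trans (∑-cong (exponents (suc N) (suc d)) λ { (b ∷ β) → refl })
             (∑-y-suc (suc j) d (g ∘ (_[ zero ]%= suc)) (G ∘ (_[ zero ]%= suc)))) ⟩
    ∑[ exponents N (suc d) ] (λ γ → g (0 ∷ γ) ⊛ G (0 ∷ γ [ j ]%= suc)) ⊕
    ∑[ exponents (suc N) d ] (λ γ → g (γ [ zero ]%= suc) ⊛ G (γ [ suc j ]%= suc [ zero ]%= suc))
      -- Increments at `zero` and at `suc j` commute by computation once the head of the vector is
      -- exposed.
      ≈⟨ +-congˡ (∑-cong (exponents (suc N) d) λ { (b ∷ β) → refl }) ⟩
    ∑[ exponents N (suc d) ] (λ γ → g (0 ∷ γ) ⊛ G (0 ∷ γ [ j ]%= suc)) ⊕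
    ∑[ exponents (suc N) d ] (λ γ → g (γ [ zero ]%= suc) ⊛ G (γ [ zero ]%= suc [ suc j ]%= suc))
      ≈⟨ ∑-exponents-suc N d _ ⟨
    ∑[ exponents (suc N) (suc d) ] (λ γ → g γ ⊛ G (γ [ suc j ]%= suc)) ∎

  -- Iterated partial derivatives

  module _ {N : ℕ} where

    ∂-cong : (i : Fin N) {f g : Poly} → f ≐ g → ∂ i f ≐ ∂ i g
    ∂-cong i f≐g α = ⋆-congʳ (suc (lookup α i)) (f≐g (α [ i ]%= suc))

    ⋆-swap : ∀ m n x → m ⋆ (n ⋆ x) ≈ n ⋆ (m ⋆ x)
    ⋆-swap m n x = trans (⋆-assocˡ x m n)
      (trans (reflexive (≡.cong (_⋆ x) (ℕ.*-comm m n))) (sym (⋆-assocˡ x n m)))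

    ∂-comm : (i j : Fin N) (f : Poly) → ∂ i (∂ j f) ≐ ∂ j (∂ i f)
    ∂-comm i j f α with i Fin.≟ j
    ... | yes ≡.refl = refl
    ... | no  i≢j    = begin
      suc (lookup α i) ⋆ (suc (lookup (α [ i ]%= suc) j) ⋆ f (α [ i ]%= suc [ j ]%= suc))
        ≡⟨ ≡.cong₂ (λ m β → suc (lookup α i) ⋆ (suc m ⋆ f β))
             (Vec.lookup∘updateAt′ j i (i≢j ∘ ≡.sym) α) (Vec.updateAt-commutes j i (i≢j ∘ ≡.sym) α) ⟩
      suc (lookup α i) ⋆ (suc (lookup α j) ⋆ f (α [ j ]%= suc [ i ]%= suc))
        ≈⟨ ⋆-swap (suc (lookup α i)) (suc (lookup α j)) _ ⟩
      suc (lookup α j) ⋆ (suc (lookup α i) ⋆ f (α [ j ]%= suc [ i ]%= suc))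
        ≡⟨ ≡.cong (λ m → suc (lookup α j) ⋆ (suc m ⋆ f (α [ j ]%= suc [ i ]%= suc)))
             (Vec.lookup∘updateAt′ i j i≢j α) ⟨
      suc (lookup α j) ⋆ (suc (lookup (α [ j ]%= suc) i) ⋆ f (α [ j ]%= suc [ i ]%= suc)) ∎

    fold-cong : (i : Fin N) (m : ℕ) {f g : Poly} → f ≐ g → fold f (∂ i) m ≐ fold g (∂ i) m
    fold-cong i zero    f≐g = f≐g
    fold-cong i (suc m) f≐g = ∂-cong i (fold-cong i m f≐g)

    fold-∂-comm : (i j : Fin N) (m : ℕ) (f : Poly) → fold (∂ j f) (∂ i) m ≐ ∂ j (fold f (∂ i) m)
    fold-∂-comm i j zero    f α = refl
    fold-∂-comm i j (suc m) f α =
      trans (∂-cong i (fold-∂-comm i j m f) α) (∂-comm i j (fold f (∂ i) m) α)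

    -- The index `j` occurs exactly once in the list along which the derivatives are taken. The
    -- extra `∂ j` appears there and is then commuted outward past the derivatives applied later.
    ∂^-suc : (j : Fin N) (β : Vec ℕ N) (p : Poly) → ∂^ (β [ j ]%= suc) p ≐ ∂ j (∂^ β p)
    ∂^-suc j β p = present (List.allFin N) (Unique.allFin⁺ N) (∈-allFin j)
      where
      ∂along : Vec ℕ N → List (Fin N) → Poly
      ∂along γ = List.foldr (λ i f → fold f (∂ i) (lookup γ i)) p

      absent : ∀ is → j ∉ is → ∂along (β [ j ]%= suc) is ≐ ∂along β is
      absent []       j∉ α = refl
      absent (i ∷ is) j∉ α
        rewrite Vec.lookup∘updateAt′ i j {suc} (λ i≡j → j∉ (here (≡.sym i≡j))) β =
        fold-cong i (lookup β i) (absent is (j∉ ∘ there)) α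

      present : ∀ is → Unique is → j ∈ is → ∂along (β [ j ]%= suc) is ≐ ∂ j (∂along β is)
      present (i ∷ is) (i∉ ∷ _) (here ≡.refl) α rewrite Vec.lookup∘updateAt i {suc} β =
        ∂-cong i (fold-cong i (lookup β i) (absent is λ i∈ → All.lookup i∉ i∈ ≡.refl)) α
      present (i ∷ is) (i∉ ∷ u) (there j∈) α
        rewrite Vec.lookup∘updateAt′ i j {suc} (All.lookup i∉ j∈) β =
        trans (fold-cong i (lookup β i) (present is u j∈) α) (fold-∂-comm i j (lookup β i) (∂along β is) α)

  -- The Koszul differential and its contracting homotopy

  κ : ∀ {N} → Form {N} → Form {N}
  κ u (X , β) = sum λ j → (x[ j ]∧ (λ Z → (y[ j ]· (λ γ → u (Z , γ))) β)) X

  κ-linear : ∀ {N} (x : Subset N × Vec ℕ N) → Linear (λ u → κ u x)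
  κ-linear (X , β) = sum-linear λ j → ∘-linear (∧-linear j X) λ Z →
    ∘-linear (y-linear j β) λ γ → coordinate-linear (Z , γ)

  private module κ {N} x = Linear (κ-linear {N} x)

  -- This is the differential of a tensor product of the complex in the first variable with that in
  -- the others; the sign comes from passing the first variable.
  κ-inside : ∀ {N} u (X : Subset N) b β → κ u (inside ∷ X , b ∷ β) ≈
             (y[ zero ]· (λ γ → u (outside ∷ X , γ))) (b ∷ β) ⊖
             κ (λ (Z , γ) → u (inside ∷ Z , b ∷ γ)) (X , β)
  κ-inside u X b β = +-congˡ (sum-neg λ j → (x[ j ]∧ (λ Z → (y[ j ]· (λ γ → u (inside ∷ Z , b ∷ γ))) β)) X)

  -- Inverts κ along the matching of Paired.
  homotopy : ∀ {N} → Form {N} → Form {N}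
  homotopy u ([]          , [])        = 0#
  homotopy u (outside ∷ X , a ∷ α)     = u (inside ∷ X , suc a ∷ α)
  homotopy u (inside  ∷ X , suc a ∷ α) = 0#
  homotopy u (inside  ∷ X , zero ∷ α)  = - homotopy (λ (Z , γ) → u (inside ∷ Z , 0 ∷ γ)) (X , α)

  homotopy-linear : ∀ {N} (x : Subset N × Vec ℕ N) → Linear (λ u → homotopy u x)
  homotopy-linear ([]          , [])        = zero-linear
  homotopy-linear (outside ∷ X , a ∷ α)     = coordinate-linear _
  homotopy-linear (inside  ∷ X , suc a ∷ α) = zero-linear
  homotopy-linear (inside  ∷ X , zero ∷ α)  =
    neg-linear (∘-linear (homotopy-linear (X , α)) λ _ → coordinate-linear _)

  -- In the case `here`, the first variable returns the coefficient of `u`, and the other terms see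
  -- `homotopy u` only where it is zero by definition. In the case `there`, the first variable
  -- contributes nothing at exponent 0, and the signs of `κ` and `homotopy` cancel.
  κ-homotopy : ∀ {N} u {X : Subset N} {α} → Paired X α → κ (homotopy u) (X , α) ≈ u (X , α)
  κ-homotopy u {inside ∷ X} {suc a ∷ α} here = begin
    κ (homotopy u) (inside ∷ X , suc a ∷ α)
      ≈⟨ κ-inside (homotopy u) X (suc a) α ⟩
    u (inside ∷ X , suc a ∷ α) ⊖ κ (λ _ → 0#) (X , α)
      ≈⟨ +-congˡ (trans (-‿cong (κ.zero-homo (X , α))) -0#≈0#) ⟩
    u (inside ∷ X , suc a ∷ α) ⊕ 0#
      ≈⟨ +-identityʳ _ ⟩
    u (inside ∷ X , suc a ∷ α) ∎
  κ-homotopy u {inside ∷ X} {zero ∷ α} (there p) = begin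
    κ (homotopy u) (inside ∷ X , 0 ∷ α)
      ≈⟨ κ-inside (homotopy u) X 0 α ⟩
    0# ⊖ κ (λ x → - homotopy u′ x) (X , α)
      ≈⟨ +-identityˡ _ ⟩
    - κ (λ x → - homotopy u′ x) (X , α)
      ≈⟨ trans (-‿cong (κ.neg (X , α) (homotopy u′))) (-‿involutive _) ⟩
    κ (homotopy u′) (X , α)
      ≈⟨ κ-homotopy u′ p ⟩
    u (inside ∷ X , 0 ∷ α) ∎
    where
    u′ : Form
    u′ (Z , γ) = u (inside ∷ Z , 0 ∷ γ)

  homotopy-vanish : ∀ {N} (P : ℕ → Set) (u : Form {N}) → (∀ X α → P ∣ X ∣ → u (X , α) ≈ 0#) →
                    ∀ X α → P (suc ∣ X ∣) → homotopy u (X , α) ≈ 0#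
  homotopy-vanish P u u≈0 []            []          PX = refl
  homotopy-vanish P u u≈0 (outside ∷ X) (a ∷ α)     PX = u≈0 _ _ PX
  homotopy-vanish P u u≈0 (inside  ∷ X) (suc a ∷ α) PX = refl
  homotopy-vanish P u u≈0 (inside  ∷ X) (zero ∷ α)  PX =
    trans (-‿cong (homotopy-vanish (P ∘ suc) _ (λ Z γ → u≈0 _ _) X α PX)) -0#≈0#

  κ-vanish : ∀ {N} (P : ℕ → Set) (u : Form {N}) → (∀ X α → P (suc ∣ X ∣) → u (X , α) ≈ 0#) →
             ∀ X α → P ∣ X ∣ → κ u (X , α) ≈ 0#
  κ-vanish {N} P u u≈0 X α PX = sum-zero {N} λ j →
    ∧-vanish P j (λ Z PZ → Linear.vanish (y-linear j α) λ γ → u≈0 Z γ PZ) X PX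

  -- The Koszul flattening annihilates the image of `κ`.

  module _ {N : ℕ} (s : ℕ) (p : Poly {N}) where

    koszul-linear : ∀ y → Linear (λ u → koszulFlattening s p u y)
    koszul-linear (Y , α) = sum-linear λ i → ∘-linear (∧-linear i Y) λ X →
      ⋆-linear (suc (lookup α i)) (∑-linear (exponents N s) λ β →
        *-linear (∂^ β p (α [ i ]%= suc)) (coordinate-linear (X , β)))

    koszul-vanish : ∀ u → (∀ X β → Vec.sum β ≡ s → u (X , β) ≈ 0#) → ∀ y → koszulFlattening s p u y ≈ 0#
    koszul-vanish u u≈0 (Y , α) = sum-zero {N} λ i → ∧.vanish i Y λ X →
      -- A multiple of zero is zero: the multiple is read as a functional applied to a constant
      -- family, so the index `(X , α)` is arbitrary.
      Linear.vanish (⋆-linear (suc (lookup α i)) (coordinate-linear (X , α)))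
        {λ _ → flattening s p (λ β → u (X , β)) (α [ i ]%= suc)} λ _ →
      ∑-zero (exponents N s) λ {β} β∈ → trans (*-congʳ (u≈0 X β (∈-exponents⁻ s β∈))) (zeroˡ _)

    koszul-expand : ∀ u Y α → koszulFlattening s p u (Y , α) ≈
      sum λ i → (x[ i ]∧ (λ X → ∑[ exponents N s ] (λ β → u (X , β) ⊛ ∂ i (∂^ β p) α))) Y
    koszul-expand u Y α = sum-cong-≋ {N} λ i → ∧.cong i Y λ X →
      ⋆-∑ (suc (lookup α i)) (exponents N s) (λ β → u (X , β)) (λ β → ∂^ β p (α [ i ]%= suc))

  ∑-κ : ∀ {N} d (u : Form {N}) (G : Poly) X →
        ∑[ exponents N d ] (λ β → κ u (X , β) ⊛ G β) ≈
        sum λ j → (x[ j ]∧ (λ Z → ∑[ exponents N d ] (λ β → (y[ j ]· (λ γ → u (Z , γ))) β ⊛ G β))) X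
  ∑-κ {N} d u G X = begin
    ∑[ exponents N d ] (λ β → sum (λ j → (x[ j ]∧ yu j β) X) ⊛ G β)
      ≈⟨ ∑-cong (exponents N d) (λ β → *-distribʳ-sum (G β) (λ j → (x[ j ]∧ yu j β) X)) ⟩
    ∑[ exponents N d ] (λ β → sum (λ j → (x[ j ]∧ yu j β) X ⊛ G β))
      ≈⟨ ∑-sum-comm (exponents N d) (λ β j → (x[ j ]∧ yu j β) X ⊛ G β) ⟩
    sum (λ j → ∑[ exponents N d ] (λ β → (x[ j ]∧ yu j β) X ⊛ G β))
      ≈⟨ sum-cong-≋ {N} (λ j → sym (∧.∑-homo j X (exponents N d) (yu j) G)) ⟩
    sum (λ j → (x[ j ]∧ (λ Z → ∑[ exponents N d ] (λ β → yu j β Z ⊛ G β))) X) ∎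
    where
    yu : Fin N → Vec ℕ N → Subset N → K
    yu j β Z = (y[ j ]· (λ γ → u (Z , γ))) β

  -- Summation by parts moves `y[ j ]·` onto `p` as a further derivative. The resulting `Ω i j` is
  -- symmetric because derivatives commute, while the exterior product with the variables `i` and
  -- `j` is alternating, so the double sum cancels. For order 0, `κ u` has no coefficient in degree
  -- 0.
  koszul-κ : ∀ {N} s (p : Poly {N}) u y → koszulFlattening s p (κ u) y ≈ 0#
  koszul-κ {N} zero p u (Y , α) = trans (koszul-expand 0 p (κ u) Y α) (sum-zero {N} λ i → ∧.vanish i Y λ X →
    trans (∑-κ 0 u (λ β → ∂ i (∂^ β p) α) X) (sum-zero {N} λ j → ∧.vanish j X λ Z →
      ∑-y-zero j (λ γ → u (Z , γ)) (λ β → ∂ i (∂^ β p) α)))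
  koszul-κ {N} (suc s) p u (Y , α) = begin
    koszulFlattening (suc s) p (κ u) (Y , α)
      ≈⟨ koszul-expand (suc s) p (κ u) Y α ⟩
    (sum λ i → (x[ i ]∧ (λ X → ∑[ exponents N (suc s) ] (λ β → κ u (X , β) ⊛ ∂ i (∂^ β p) α))) Y)
      ≈⟨ sum-cong-≋ {N} (λ i → ∧.cong i Y λ X → trans (∑-κ (suc s) u (λ β → ∂ i (∂^ β p) α) X)
           (sum-cong-≋ {N} λ j → ∧.cong j X λ Z → ∑-y-suc j s (λ γ → u (Z , γ)) (λ β → ∂ i (∂^ β p) α))) ⟩
    (sum λ i → (x[ i ]∧ (λ X → sum λ j → (x[ j ]∧ Ω i j) X)) Y)
      ≈⟨ sum-cong-≋ {N} (λ i → ∧.sum-homo i Y (λ j → x[ j ]∧ Ω i j)) ⟩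
    (sum λ i → sum λ j → (x[ i ]∧ (x[ j ]∧ Ω i j)) Y)
      ≈⟨ alternating⇒sum≈0 _ (λ i → ∧-alternating i (Ω i i) Y) (λ i j → trans
           (∧-anticomm i j (Ω i j) Y)
           (-‿cong (∧.cong j Y λ X → ∧.cong i X (Ω-sym i j)))) ⟩
    0# ∎
    where
    Ω : Fin N → Fin N → Subset N → K
    Ω i j Z = ∑[ exponents N s ] (λ γ → u (Z , γ) ⊛ ∂ i (∂^ (γ [ j ]%= suc) p) α)

    Ω-sym : ∀ i j → Ω i j ≐ Ω j i
    Ω-sym i j Z = ∑-cong (exponents N s) λ γ → *-congˡ (begin
      ∂ i (∂^ (γ [ j ]%= suc) p) α  ≈⟨ ∂-cong i (∂^-suc j γ p) α ⟩
      ∂ i (∂ j (∂^ γ p)) α          ≈⟨ ∂-comm i j (∂^ γ p) α ⟩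
      ∂ j (∂ i (∂^ γ p)) α          ≈⟨ ∂-cong j (∂^-suc i γ p) α ⟨
      ∂ j (∂^ (γ [ i ]%= suc) p) α  ∎)

  -- Reduction to unpaired coefficients and the rank bound.

  residue : ∀ {N} → Form {N} → Form {N}
  residue u x = u x ⊖ κ (homotopy u) x

  residue-linear : ∀ {N} (x : Subset N × Vec ℕ N) → Linear (λ u → residue u x)
  residue-linear x =
    +-linear (coordinate-linear x) (neg-linear (∘-linear (κ-linear x) homotopy-linear))

  koszul-residue : ∀ {N} s (p : Poly {N}) u y →
                   koszulFlattening s p u y ≈ koszulFlattening s p (residue u) y
  koszul-residue s p u y = begin
    koszulFlattening s p u y
      ≈⟨ cong (λ x → sym (trans (+-assoc _ _ _) (trans (+-congˡ (-‿inverseˡ _)) (+-identityʳ (u x))))) ⟩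
    koszulFlattening s p (λ x → residue u x ⊕ κ (homotopy u) x) y
      ≈⟨ distrib-+ (residue u) (κ (homotopy u)) ⟩
    koszulFlattening s p (residue u) y ⊕ koszulFlattening s p (κ (homotopy u)) y
      ≈⟨ +-congˡ (koszul-κ s p (homotopy u) y) ⟩
    koszulFlattening s p (residue u) y ⊕ 0#
      ≈⟨ +-identityʳ _ ⟩
    koszulFlattening s p (residue u) y ∎
    where open Linear (koszul-linear s p y)

  -- For a wrong exterior degree both terms vanish, since `homotopy` lowers that degree by one and
  -- `κ` restores it. At paired vectors the terms cancel by `κ-homotopy`; the unpaired ones are
  -- covered by the premise.
  residue-vanish : ∀ {N} q s (u : Form {N}) → (Λ^ (+ q) ⊗S^ s) u →
    (∀ {x} → x ∈ unpairedBasis N (+ q) s → residue u x ≈ 0#) →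
    ∀ X β → Vec.sum β ≡ s → residue u (X , β) ≈ 0#
  residue-vanish {N} q s u u∈ ≈0 X β Σβ≡s with ∣ X ∣ ℕ.≟ q
  ... | no ∣X∣≢q = trans
    (+-cong (off X β ∣X∣≢q) (-‿cong (κ-vanish (_≢ q) (homotopy u) (homotopy-vanish (_≢ q) u off) X β ∣X∣≢q)))
    (-‿inverseʳ 0#)
    where
    off : ∀ Z γ → ∣ Z ∣ ≢ q → u (Z , γ) ≈ 0#
    off Z γ ∣Z∣≢q = u∈ Z γ (∣Z∣≢q ∘ ℤ.+-injective ∘ proj₁)
  ... | yes ∣X∣≡q with paired? X β
  ...   | yes P = trans (+-congˡ (-‿cong (κ-homotopy u P))) (-‿inverseʳ _)
  ...   | no ¬P = ≈0 (∈-filter⁺ (¬? ∘ uncurry paired?) (∈-basisΛ⊗S⁺ (≡.cong +_ ∣X∣≡q) Σβ≡s) ¬P)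

  -- Preimages of an independent family in the image have independent residues at the unpaired basis
  -- vectors: a relation there yields a combination `w` whose residue is invisible to the
  -- flattening, hence a relation among the given images.
  koszul-rank : ∀ {N} s (p : Poly {N}) q →
    RankAtMost (koszulFlattening s p) (Λ^ (+ q) ⊗S^ s) (+ length (unpairedBasis N (+ q) s))
  koszul-rank {N} s p q n v v∈ ind = ℤ.+≤+ (independent⇒≤ coordinates coordinates-independent)
    where
    B : List (Subset N × Vec ℕ N)
    B = unpairedBasis N (+ q) s

    u : Fin n → Form
    u m = proj₁ (v∈ m)

    coordinates : Fin n → Fin (length B) → K
    coordinates m l = residue (u m) (List.lookup B l)

    coordinates-independent : Independent coordinates
    coordinates-independent a a≐0 = ind a λ y → begin
      combination a v y
        ≈⟨ sum-cong-≋ {n} (λ m → *-congˡ (proj₂ (proj₂ (v∈ m)) y)) ⟩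
      sum (λ m → a m ⊛ koszulFlattening s p (u m) y)
        ≈⟨ Linear.combination-homo (koszul-linear s p y) a u ⟨
      koszulFlattening s p w y
        ≈⟨ koszul-residue s p w y ⟩
      koszulFlattening s p (residue w) y
        ≈⟨ koszul-vanish s p (residue w) (residue-vanish q s w w∈ residue-w≈0) y ⟩
      0# ∎
      where
      w : Form
      w = combination a u

      w∈ : (Λ^ (+ q) ⊗S^ s) w
      w∈ X α ∉deg = sum-zero {n} λ m → trans (*-congˡ (proj₁ (proj₂ (v∈ m)) X α ∉deg)) (zeroʳ (a m))

      residue-w≈0 : ∀ {x} → x ∈ B → residue w x ≈ 0#
      residue-w≈0 {x} x∈ = trans (Linear.combination-homo (residue-linear x) a u)
        (≡.subst (λ x → sum (λ m → a m ⊛ residue (u m) x) ≈ 0#) (≡.sym (lookup-index x∈))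
          (a≐0 (Any.index x∈)))

proposition17 : ∀ {c ℓ₁ ℓ₂} (F : HeytingField c ℓ₁ ℓ₂) → let open KoszulFlattening F in
    CharacteristicZero →
    ∀ (N k : ℕ) (p : Poly {N}) → S^ (2 * k + 1) p →
    ∀ (q : ℕ) → q ≤ N →
    RankAtMost (koszulFlattening k p) (Λ^ (+ q) ⊗S^ k)
    (alternatingSum k (λ j → dimΛ⊗S N (+ q - + j) (k ∸ j)))
proposition17 F _ N k p _ q q≤N = ≡.subst
  (KoszulFlattening.RankAtMost F (KoszulFlattening.koszulFlattening F k p) (KoszulFlattening.Λ^_⊗S^_ F (+ q) k))
  (unpairedBasis-length k (ℤ.+≤+ q≤N)) (koszul-rank F k p q)
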